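{- Let $A\subseteq\omega$ be an infinite c.e. set. Every countable partially ordered set can be isomorphically embedded into the Rogers semi-lattice of computable numberings of $\mathcal S^{(1)}_A$; that is, for every countable partially ordered set $(P,\le_P)$ there is an injective map $J$ from $P$ into the set $[\mathrm{BN}_A]$ of $m$-equivalence classes of computable numberings of $\mathcal S^{(1)}_A$ such that for all $p,q\in P$: $p\le_P q$ if and only if $J(p)\le J(q)$.
   Context: $\omega$ is the set of natural numbers; $\mathcal R^{(n)}$ is the set of total computable functions $\omega^n\to\omega$. $\langle\cdot,\cdot\rangle:\omega^2\to\omega$ is a computable bijection with $\langle x,y\rangle\ge x,y$. $\mathrm{Anf}^{(1)}_A$ is the set of partial functions from $\omega$ to $\omega$ whose domain is either empty or equal to $\{0,\dots,a-1\}$ for some $a\in A$, and $\mathcal S^{(1)}_A=\mathcal R^{(1)}\cup\mathrm{Anf}^{(1)}_A$. A numbering of a set $X$ is a surjection $\omega\to X$. A numbering $\eta$ of $\mathcal S^{(1)}_A$ is computable if it satisfies (QGN I): the extended graph $\{\langle\langle i,x\rangle,0\rangle:i,x\in\omega\}\cup\{\langle\langle i,x\rangle,\eta_i(x)+1\rangle:x\in\mathrm{dom}(\eta_i)\}$ of its universal function $(i,x)\mapsto\eta_i(x)$ is the range of a function in $\mathcal R^{(1)}$ (equivalently, the universal function is partial computable). $\mathrm{BN}_A$ is the set of computable numberings of $\mathcal S^{(1)}_A$. For numberings $\eta,\gamma$ of $\mathcal S^{(1)}_A$, $\eta\le_m\gamma$ means $\eta=\gamma\circ g$ for some $g\in\mathcal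 R^{(1)}$, and $\eta,\gamma$ are $m$-equivalent if $\eta\le_m\gamma$ and $\gamma\le_m\eta$; $[\eta]$ is the $m$-equivalence class of $\eta$, and $[\eta]\le[\gamma]$ iff $\eta\le_m\gamma$. The Rogers semi-lattice of computable numberings of $\mathcal S^{(1)}_A$ is the set $[\mathrm{BN}_A]$ of $m$-equivalence classes of elements of $\mathrm{BN}_A$ with this partial order. -}

module Defs where

open import Data.Fin.Base using (Fin; zero)
open import Data.List.Membership.Propositional using (_∈_)
open import Data.Nat.Base using (ℕ; zero; suc; _<_; _≤_)
open import Data.Product.Base using (∃-syntax; ∃₂; _×_; _,_; uncurry)
open import Data.Sum.Base using (_⊎_)
open import Data.Vec.Base using (Vec; []; _∷_; lookup)
open import Data.Vec.N-ary using (N-ary; _$ⁿ_)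
open import Data.Vec.Relation.Binary.Pointwise.Inductive using (Pointwise; []; _∷_)
open import Function.Base using (id; _∘_)
open import Function.Bundles using (_⇔_; mk⇔; Equivalence; Injection)
open import Function.Definitions using (Bijective)
open import Level using (0ℓ; _⊔_) renaming (suc to lsuc)
open import Relation.Binary.Bundles using (Poset)
open import Relation.Binary.PropositionalEquality using (_≡_; setoid)
import Relation.Binary.Construct.Interior.Symmetric as Interior
open import Relation.Binary.Morphism.Structures using (IsOrderMonomorphism)
open import Relation.Nullary.Negation using (¬_)
open import Relation.Unary using (Pred)

-- Codes of Kleene's μ-recursive functions; Code n is for arity n.
data Code : ℕ → Set where
  zero    : Code 0
  suc     : Code 1
  proj    : ∀ {n} → Fin n → Code n
  comp    : ∀ {m n} → Code m → Vec (Code n) m → Code n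
  primrec : ∀ {n} → Code n → Code (suc (suc n)) → Code (suc n)
  μ       : ∀ {n} → Code (suc n) → Code n

infix 4 _[_]⇓_

-- c [ xs ]⇓ y : the partial function with code c is defined at xs, with
-- value y.  The recursion (resp. minimisation) variable comes first; in
-- primrec g h, the arguments of h are the predecessor, the previous value
-- and the parameters, in this order.
data _[_]⇓_ : ∀ {n} → Code n → Vec ℕ n → ℕ → Set where
  zero⇓    : zero [ [] ]⇓ 0
  suc⇓     : ∀ {x} → suc [ x ∷ [] ]⇓ suc x
  proj⇓    : ∀ {n} {xs : Vec ℕ n} {i} → proj i [ xs ]⇓ lookup xs i
  comp⇓    : ∀ {m n} {c : Code m} {ds : Vec (Code n) m} {xs ys z} →
             Pointwise (λ d y → d [ xs ]⇓ y) ds ys → c [ ys ]⇓ z →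
             comp c ds [ xs ]⇓ z
  primrec0 : ∀ {n} {g : Code n} {h xs y} →
             g [ xs ]⇓ y → primrec g h [ 0 ∷ xs ]⇓ y
  primrecS : ∀ {n} {g : Code n} {h k xs y z} →
             primrec g h [ k ∷ xs ]⇓ y → h [ k ∷ y ∷ xs ]⇓ z →
             primrec g h [ suc k ∷ xs ]⇓ z
  μ⇓       : ∀ {n} {c : Code (suc n)} {xs y} →
             (∀ {i} → i < y → ∃[ k ] c [ i ∷ xs ]⇓ suc k) →
             c [ y ∷ xs ]⇓ 0 →
             μ c [ xs ]⇓ y

ℛ : (n : ℕ) → Pred (N-ary n ℕ ℕ) 0ℓ
ℛ n f = ∃[ c ] (∀ xs → c [ xs ]⇓ (f $ⁿ xs))

ℛ-id : ℛ 1 id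
ℛ-id = proj zero , λ { (x ∷ []) → proj⇓ }

ℛ-∘ : ∀ {f g} → ℛ 1 f → ℛ 1 g → ℛ 1 (f ∘ g)
ℛ-∘ {f} {g} (c , c⇓) (d , d⇓) =
  comp c (d ∷ []) ,
  λ { (x ∷ []) → comp⇓ (d⇓ (x ∷ []) ∷ []) (c⇓ (g x ∷ [])) }

IsRangeOf : Pred ℕ 0ℓ → (ℕ → ℕ) → Set
IsRangeOf A f = ∀ y → A y ⇔ (∃[ x ] f x ≡ y)

ComputablyEnumerable : Pred ℕ 0ℓ → Set
ComputablyEnumerable A =
  (∀ x → ¬ A x) ⊎ (∃[ f ] ℛ 1 f × IsRangeOf A f)

Infinite : Pred ℕ 0ℓ → Set
Infinite A = ¬ (∃[ xs ] (∀ a → A a → a ∈ xs))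

record Pairing : Set where
  field
    ⟨_,_⟩      : ℕ → ℕ → ℕ
    computable : ℛ 2 ⟨_,_⟩
    bijective  : Bijective _≡_ _≡_ (uncurry ⟨_,_⟩)
    fst≤       : ∀ x y → x ≤ ⟨ x , y ⟩
    snd≤       : ∀ x y → y ≤ ⟨ x , y ⟩

record PartialFunction : Set₁ where
  field
    _↦_        : ℕ → ℕ → Set
    functional : ∀ {x y z} → _↦_ x y → _↦_ x z → y ≡ z

  Dom : Pred ℕ 0ℓ
  Dom x = ∃[ y ] _↦_ x y

open PartialFunction public using (Dom)

graph : PartialFunction → ℕ → ℕ → Set
graph = PartialFunction._↦_

infix 4 _≐_

_≐_ : PartialFunction → PartialFunction → Set
f ≐ g = ∀ x y → graph f x y ⇔ graph g x y

≐-refl : ∀ {f} → f ≐ f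
≐-refl x y = mk⇔ id id

≐-trans : ∀ {f g h} → f ≐ g → g ≐ h → f ≐ h
≐-trans p q x y =
  mk⇔ (Equivalence.to (q x y) ∘ Equivalence.to (p x y))
      (Equivalence.from (p x y) ∘ Equivalence.from (q x y))

ℛ¹ : Pred PartialFunction 0ℓ
ℛ¹ f = ∃[ g ] ℛ 1 g × (∀ x y → graph f x y ⇔ g x ≡ y)

Anf : Pred ℕ 0ℓ → Pred PartialFunction 0ℓ
Anf A f = (∀ x → ¬ Dom f x) ⊎ (∃[ a ] A a × (∀ x → Dom f x ⇔ x < a))

𝒮 : Pred ℕ 0ℓ → Pred PartialFunction 0ℓ
𝒮 A f = ℛ¹ f ⊎ Anf A f

IsNumbering : Pred PartialFunction 0ℓ → (ℕ → PartialFunction) → Set₁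
IsNumbering X η = (∀ i → X (η i)) × (∀ f → X f → ∃[ i ] η i ≐ f)

module _ (π : Pairing) where
  open Pairing π

  ExtendedGraph : (ℕ → PartialFunction) → Pred ℕ 0ℓ
  ExtendedGraph η n =
    (∃₂ λ i x → n ≡ ⟨ ⟨ i , x ⟩ , 0 ⟩) ⊎
    (∃[ i ] ∃[ x ] ∃[ y ] graph (η i) x y × n ≡ ⟨ ⟨ i , x ⟩ , suc y ⟩)

  IsComputable : (ℕ → PartialFunction) → Set
  IsComputable η = ∃[ f ] ℛ 1 f × IsRangeOf (ExtendedGraph η) f

  record BN (A : Pred ℕ 0ℓ) : Set₁ where
    field
      η            : ℕ → PartialFunction
      isNumbering  : IsNumbering (𝒮 A) η
      isComputable : IsComputable η

infix 4 _≤ₘ_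

_≤ₘ_ : (η γ : ℕ → PartialFunction) → Set
η ≤ₘ γ = ∃[ g ] ℛ 1 g × (∀ i → η i ≐ γ (g i))

≤ₘ-refl : ∀ {η} → η ≤ₘ η
≤ₘ-refl {η} = id , ℛ-id , λ i → ≐-refl {η i}

≤ₘ-trans : ∀ {η γ δ} → η ≤ₘ γ → γ ≤ₘ δ → η ≤ₘ δ
≤ₘ-trans {η} {γ} {δ} (g , cg , p) (h , ch , q) =
  h ∘ g , ℛ-∘ {h} {g} ch cg ,
  λ i → ≐-trans {η i} {γ (g i)} {δ (h (g i))} (p i) (q (g i))

-- The set of m-equivalence classes is BN π A with m-equivalence, i.e. ≤ₘ in
-- both directions, as its underlying equality.
Rogers : Pairing → Pred ℕ 0ℓ → Poset (lsuc 0ℓ) 0ℓ 0ℓ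
Rogers π A = Interior.poset {A = BN π A} {R = λ β γ → BN.η β ≤ₘ BN.η γ}
  (λ {β} → ≤ₘ-refl {BN.η β})
  (λ {β} {γ} {δ} → ≤ₘ-trans {BN.η β} {BN.η γ} {BN.η δ})

Countable : ∀ {c ℓ₁ ℓ₂} → Poset c ℓ₁ ℓ₂ → Set (c ⊔ ℓ₁)
Countable P = Injection (Poset.Eq.setoid P) (setoid ℕ)

EmbedsInto : ∀ {c₁ ℓ₁ ℓ₂ c₂ ℓ₃ ℓ₄} → Poset c₁ ℓ₁ ℓ₂ → Poset c₂ ℓ₃ ℓ₄ →
             Set (c₁ ⊔ ℓ₁ ⊔ ℓ₂ ⊔ c₂ ⊔ ℓ₃ ⊔ ℓ₄)
EmbedsInto P Q =
  ∃[ J ] IsOrderMonomorphism (Poset._≈_ P) (Poset._≈_ Q) (Poset._≤_ P) (Poset._≤_ Q) J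

{-# OPTIONS --safe #-}

-- The numberings differ only in which special indices are active.  Every
-- computable set b yields a numbering η b in which the indices ⟨ suc t , p ⟩ list
-- the nonempty members of 𝒮 A, while ⟨ 0 , ⟨ k , e ⟩ ⟩ is empty for k outside b.
-- For k in b the index i = ⟨ 0 , ⟨ k , e ⟩ ⟩ waits for the e-th program to output
-- some j at i: it stays empty if j is a nonempty index, and becomes a finite
-- function whose values determine i if j is special.  Hence a program that reduces
-- η b to η b′ sends i to i, and so k belongs to b′: reducibility is inclusion of b
-- in b′, and it remains to embed P into the computable sets under inclusion.
module Submission where

open import Defs
open import Axiom.ExcludedMiddle using (ExcludedMiddle)
open import Data.Empty using (⊥; ⊥-elim)
open import Data.Fin.Base using (Fin; zero; suc)
open import Data.Fin.Patterns using (0F; 1F; 2F; 3F)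
open import Data.List.Base as List using (upTo)
open import Data.List.Membership.Propositional.Properties using (∈-upTo⁺)
open import Data.Nat.Base
open import Data.Nat.Induction using (<-rec)
open import Data.Nat.Properties
open import Data.Product.Base using (∃-syntax; _×_; _,_; proj₁; proj₂; uncurry)
open import Data.Sum.Base as Sum using (_⊎_; inj₁; inj₂; [_,_]′)
open import Data.Unit.Base using (tt)
open import Data.Vec.Base using (Vec; []; _∷_; lookup; head; tail)
open import Data.Vec.N-ary using (N-ary)
open import Data.Vec.Relation.Binary.Pointwise.Inductive using (Pointwise; []; _∷_)
open import Function.Base using (id; _∘_)
open import Function.Bundles using (_⇔_; mk⇔; Equivalence; Injection)
open import Function.Construct.Composition using (_⇔-∘_)
open import Level using (0ℓ)
open import Relation.Binary.Bundles using (Poset)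
open import Relation.Binary.Construct.Interior.Symmetric using (_,_)
open import Relation.Binary.Definitions using (tri<; tri≈; tri>)
open import Relation.Binary.PropositionalEquality
open import Relation.Nullary.Decidable using (decidable-stable; toSum)
open import Relation.Nullary using (¬_; Dec; yes; no; contradiction)
open import Relation.Unary using (Pred)

-- Every `η b n` has to lie in `𝒮 A`, although a program may converge on any c.e. set; so a value is
-- released only once the program has converged on a whole segment whose length `α` has enumerated.
-- The diagonal argument needs a computable split of the indices into those that are never empty and
-- those that may be, although emptiness is undecidable; so a nonempty index carries the stage at
-- which a value at `0` was released. No recursion theorem is involved, because the program `e` to
-- be defeated is itself a component of `i`. The sets are computable rather than c.e. because the
-- reduction that inclusion yields must recognise the special indices with `k` outside `b` and send
-- them to an empty index, even when `k` lies in `b′`.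

-- Closure properties of the computable functions.

cond : ℕ → ℕ → ℕ → ℕ
cond zero    a b = a
cond (suc _) a b = b

-- With positive numbers as truth values, `∑<` and `∏<` act as the bounded quantifiers `∃` and `∀`.
∑< : ℕ → (ℕ → ℕ) → ℕ
∑< zero    f = 0
∑< (suc k) f = f k + ∑< k f

∏< : ℕ → (ℕ → ℕ) → ℕ
∏< zero    f = 1
∏< (suc k) f = f k * ∏< k f

-- `ℛ` takes its arguments one by one. With a single vector the closure lemmas hold for all arities
-- at once, and a program is written by mirroring the expression that it computes.
record Computable {n} (f : Vec ℕ n → ℕ) : Set where
  constructor computable
  field
    code    : Code n
    correct : ∀ xs → code [ xs ]⇓ f xs

private variable
  n : ℕ
  f g h : Vec ℕ n → ℕ

Computable-cong : (∀ xs → f xs ≡ g xs) → Computable f → Computable g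
Computable-cong eq (computable c ok) =
  computable c (λ xs → subst (c [ xs ]⇓_) (eq xs) (ok xs))

var : (i : Fin n) → Computable (λ xs → lookup xs i)
var i = computable (proj i) (λ _ → proj⇓)

app₁ : (φ : N-ary 1 ℕ ℕ) → ℛ 1 φ → Computable f → Computable (λ xs → φ (f xs))
app₁ φ (c , ok) (computable d ok₁) =
  computable (comp c (d ∷ [])) (λ xs → comp⇓ (ok₁ xs ∷ []) (ok (_ ∷ [])))

app₂ : (φ : N-ary 2 ℕ ℕ) → ℛ 2 φ → Computable f → Computable g →
       Computable (λ xs → φ (f xs) (g xs))
app₂ φ (c , ok) (computable d₁ ok₁) (computable d₂ ok₂) =
  computable (comp c (d₁ ∷ d₂ ∷ []))
             (λ xs → comp⇓ (ok₁ xs ∷ ok₂ xs ∷ []) (ok (_ ∷ _ ∷ [])))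

app₃ : (φ : N-ary 3 ℕ ℕ) → ℛ 3 φ → Computable f → Computable g → Computable h →
       Computable (λ xs → φ (f xs) (g xs) (h xs))
app₃ φ (c , ok) (computable d₁ ok₁) (computable d₂ ok₂) (computable d₃ ok₃) =
  computable (comp c (d₁ ∷ d₂ ∷ d₃ ∷ []))
             (λ xs → comp⇓ (ok₁ xs ∷ ok₂ xs ∷ ok₃ xs ∷ []) (ok (_ ∷ _ ∷ _ ∷ [])))

lam₁ : {φ : N-ary 1 ℕ ℕ} → Computable {1} (λ xs → φ (lookup xs 0F)) → ℛ 1 φ
lam₁ (computable c ok) = c , λ { xs@(_ ∷ []) → ok xs }

lam₂ : {φ : N-ary 2 ℕ ℕ} →
       Computable {2} (λ xs → φ (lookup xs 0F) (lookup xs 1F)) → ℛ 2 φ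
lam₂ (computable c ok) = c , λ { xs@(_ ∷ _ ∷ []) → ok xs }

lam₃ : {φ : N-ary 3 ℕ ℕ} →
       Computable {3} (λ xs → φ (lookup xs 0F) (lookup xs 1F) (lookup xs 2F)) → ℛ 3 φ
lam₃ (computable c ok) = c , λ { xs@(_ ∷ _ ∷ _ ∷ []) → ok xs }

‵suc : Computable f → Computable (λ xs → suc (f xs))
‵suc = app₁ suc (suc , λ { (_ ∷ []) → suc⇓ })

‵const : (k : ℕ) → Computable {n} (λ _ → k)
‵const zero    = computable (comp zero []) (λ _ → comp⇓ [] zero⇓)
‵const (suc k) = ‵suc (‵const k)

select : ∀ {m} → (Fin m → Fin n) → Vec (Code n) m
select {m = zero}  ρ = []
select {m = suc m} ρ = proj (ρ zero) ∷ select (ρ ∘ suc)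

select⇓ : ∀ {m} (ρ : Fin m → Fin n) xs ys → (∀ i → lookup xs (ρ i) ≡ lookup ys i) →
          Pointwise (λ d y → d [ xs ]⇓ y) (select ρ) ys
select⇓ ρ xs []       eq = []
select⇓ ρ xs (y ∷ ys) eq =
  subst (proj (ρ zero) [ xs ]⇓_) (eq zero) proj⇓ ∷ select⇓ (ρ ∘ suc) xs ys (eq ∘ suc)

-- The step of a recursion receives the previous value between the counter and the parameters; a
-- summand or factor ignores it.
‵skip : {f : Vec ℕ (suc n) → ℕ} → Computable f →
        Computable (λ (xs : Vec ℕ (2 + n)) → f (head xs ∷ tail (tail xs)))
‵skip (computable c ok) =
  computable (comp c (proj zero ∷ select (λ i → suc (suc i))))
    λ { xs@(x ∷ _ ∷ ys) →
        comp⇓ (proj⇓ ∷ select⇓ _ xs ys (λ _ → refl)) (ok (x ∷ ys)) }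

recur : (Vec ℕ n → ℕ) → (Vec ℕ (2 + n) → ℕ) → ℕ → Vec ℕ n → ℕ
recur g h zero    xs = g xs
recur g h (suc k) xs = h (k ∷ recur g h k xs ∷ xs)

‵recur : {g : Vec ℕ n → ℕ} {h : Vec ℕ (2 + n) → ℕ} {f : Vec ℕ n → ℕ} →
         Computable g → Computable h → Computable f →
         Computable (λ xs → recur g h (f xs) xs)
‵recur {n} {g} {h} {f} (computable c okᶜ) (computable d okᵈ) (computable e okᵉ) =
  computable (comp (primrec c d) (e ∷ select id))
             (λ xs → comp⇓ (okᵉ xs ∷ select⇓ id xs xs (λ _ → refl)) (loop (f xs) xs))
  where
  loop : ∀ k xs → primrec c d [ k ∷ xs ]⇓ recur g h k xs
  loop zero    xs = primrec0 (okᶜ xs)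
  loop (suc k) xs = primrecS (loop k xs) (okᵈ _)

‵cond : Computable f → Computable g → Computable h →
        Computable (λ xs → cond (f xs) (g xs) (h xs))
‵cond = app₃ cond (lam₃ (Computable-cong (λ xs → helper (lookup xs 0F) xs)
          (‵recur (var 1F) (var (suc (suc 2F))) (var 0F))))
  where
  helper : ∀ k xs → recur (λ xs → lookup xs 1F) (λ xs → lookup xs (suc (suc 2F))) k xs
         ≡ cond k (lookup xs 1F) (lookup xs 2F)
  helper zero    xs = refl
  helper (suc k) xs = refl

‵pred : Computable f → Computable (λ xs → pred (f xs))
‵pred = app₁ pred (lam₁ (Computable-cong (λ xs → helper (lookup xs 0F) xs)
          (‵recur (‵const 0) (var 0F) (var 0F))))
  where
  helper : ∀ k (xs : Vec ℕ 1) → recur (λ _ → 0) (λ xs → lookup xs 0F) k xs ≡ pred k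
  helper zero    xs = refl
  helper (suc k) xs = refl

infixl 6 _‵+_ _‵∸_
infixl 7 _‵*_

_‵+_ : Computable f → Computable g → Computable (λ xs → f xs + g xs)
_‵+_ = app₂ _+_ (lam₂ (Computable-cong (λ xs → helper (lookup xs 0F) xs)
         (‵recur (var 1F) (‵suc (var 1F)) (var 0F))))
  where
  helper : ∀ k (xs : Vec ℕ 2) →
           recur (λ xs → lookup xs 1F) (λ xs → suc (lookup xs 1F)) k xs ≡ k + lookup xs 1F
  helper zero    xs = refl
  helper (suc k) xs = cong suc (helper k xs)

_‵∸_ : Computable f → Computable g → Computable (λ xs → f xs ∸ g xs)
_‵∸_ = app₂ _∸_ (lam₂ (Computable-cong (λ xs → helper (lookup xs 1F) xs)
         (‵recur (var 0F) (‵pred (var 1F)) (var 1F))))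
  where
  helper : ∀ k (xs : Vec ℕ 2) →
           recur (λ xs → lookup xs 0F) (λ xs → pred (lookup xs 1F)) k xs ≡ lookup xs 0F ∸ k
  helper zero    xs = refl
  helper (suc k) xs = trans (cong pred (helper k xs)) (pred[m∸n]≡m∸[1+n] (lookup xs 0F) k)

_‵*_ : Computable f → Computable g → Computable (λ xs → f xs * g xs)
_‵*_ = app₂ _*_ (lam₂ (Computable-cong (λ xs → helper (lookup xs 0F) xs)
         (‵recur (‵const 0) (var 3F ‵+ var 1F) (var 0F))))
  where
  helper : ∀ k (xs : Vec ℕ 2) →
           recur (λ _ → 0) (λ xs → lookup xs 3F + lookup xs 1F) k xs ≡ k * lookup xs 1F
  helper zero    xs = refl
  helper (suc k) xs@(_ ∷ y ∷ []) = cong (y +_) (helper k xs)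

‵∑< : {f : Vec ℕ (suc n) → ℕ} → Computable g → Computable f →
      Computable (λ xs → ∑< (g xs) (λ t → f (t ∷ xs)))
‵∑< {n} {g} {f} cg cf = Computable-cong (λ xs → helper (g xs) xs)
                          (‵recur (‵const 0) (‵skip cf ‵+ var 1F) cg)
  where
  helper : ∀ k (xs : Vec ℕ n) →
           recur (λ _ → 0) (λ xs → f (head xs ∷ tail (tail xs)) + lookup xs 1F) k xs
         ≡ ∑< k (λ t → f (t ∷ xs))
  helper zero    xs = refl
  helper (suc k) xs = cong (f (k ∷ xs) +_) (helper k xs)

‵∏< : {f : Vec ℕ (suc n) → ℕ} → Computable g → Computable f →
      Computable (λ xs → ∏< (g xs) (λ t → f (t ∷ xs)))
‵∏< {n} {g} {f} cg cf = Computable-cong (λ xs → helper (g xs) xs)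
                          (‵recur (‵const 1) (‵skip cf ‵* var 1F) cg)
  where
  helper : ∀ k (xs : Vec ℕ n) →
           recur (λ _ → 1) (λ xs → f (head xs ∷ tail (tail xs)) * lookup xs 1F) k xs
         ≡ ∏< k (λ t → f (t ∷ xs))
  helper zero    xs = refl
  helper (suc k) xs = cong (f (k ∷ xs) *_) (helper k xs)

‵μ : {f : Vec ℕ (suc n) → ℕ} (m : Vec ℕ n → ℕ) → Computable f →
     (∀ xs {i} → i < m xs → 0 < f (i ∷ xs)) → (∀ xs → f (m xs ∷ xs) ≡ 0) → Computable m
‵μ {f = f} m (computable c ok) below at = computable (μ c) λ xs →
  μ⇓ (λ {i} i<m → pred (f (i ∷ xs)) ,
        subst (c [ i ∷ xs ]⇓_) (sym (suc-pred _ {{>-nonZero (below xs i<m)}})) (ok (i ∷ xs)))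
     (subst (c [ m xs ∷ xs ]⇓_) (at xs) (ok _))

-- Truth values are numbers, and n is true when 0 < n.

0<+⇒ : ∀ m {k} → 0 < m + k → 0 < m ⊎ 0 < k
0<+⇒ zero    p = inj₂ p
0<+⇒ (suc m) p = inj₁ z<s

0<*⇒ : ∀ m {k} → 0 < m * k → 0 < m × 0 < k
0<*⇒ (suc m) {zero}  p = ⊥-elim (n≮0 (subst (0 <_) (*-zeroʳ m) p))
0<*⇒ (suc m) {suc k} p = z<s , z<s

0<∑< : ∀ k {f t} → t < k → 0 < f t → 0 < ∑< k f
0<∑< (suc k) {f} {t} t<1+k p with m<1+n⇒m<n∨m≡n t<1+k
... | inj₁ t<k  = <-≤-trans (0<∑< k t<k p) (m≤n+m _ (f k))
... | inj₂ refl = <-≤-trans p (m≤m+n (f k) _)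

0<∑<⇒ : ∀ k {f} → 0 < ∑< k f → ∃[ t ] t < k × 0 < f t
0<∑<⇒ (suc k) {f} p with 0<+⇒ (f k) p
... | inj₁ q = k , ≤-refl , q
... | inj₂ q with t , t<k , r ← 0<∑<⇒ k q = t , m<n⇒m<1+n t<k , r

0<∏< : ∀ k {f} → (∀ {t} → t < k → 0 < f t) → 0 < ∏< k f
0<∏< zero    p = z<s
0<∏< (suc k) p = *-mono-< (p ≤-refl) (0<∏< k (p ∘ m<n⇒m<1+n))

0<∏<⇒ : ∀ k {f} → 0 < ∏< k f → ∀ {t} → t < k → 0 < f t
0<∏<⇒ (suc k) {f} p t<1+k with 0<*⇒ (f k) p | m<1+n⇒m<n∨m≡n t<1+k
... | _ , q | inj₁ t<k  = 0<∏<⇒ k q t<k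
... | q , _ | inj₂ refl = q

differ : ℕ → ℕ → ℕ
differ m n = (m ∸ n) + (n ∸ m)

‵differ : Computable f → Computable g → Computable (λ xs → differ (f xs) (g xs))
‵differ cf cg = (cf ‵∸ cg) ‵+ (cg ‵∸ cf)

0<differ : ∀ {m n} → m ≢ n → 0 < differ m n
0<differ {m} {n} m≢n with <-cmp m n
... | tri< m<n _ _ = <-≤-trans (m<n⇒0<n∸m m<n) (m≤n+m _ (m ∸ n))
... | tri≈ _ m≡n _ = contradiction m≡n m≢n
... | tri> _ _ n<m = <-≤-trans (m<n⇒0<n∸m n<m) (m≤m+n (m ∸ n) _)

differ-refl : ∀ n → differ n n ≡ 0
differ-refl n = cong₂ _+_ (n∸n≡0 n) (n∸n≡0 n)

≮0⇒≡0 : ∀ {n} → ¬ 0 < n → n ≡ 0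
≮0⇒≡0 p = n≤0⇒n≡0 (≮⇒≥ p)

-- Computable projections of the pairing.

module Pairs (π : Pairing) where
  open Pairing π public using (⟨_,_⟩; fst≤; snd≤)

  abstract
    fst snd : ℕ → ℕ
    fst m = proj₁ (proj₁ (proj₂ (Pairing.bijective π) m))
    snd m = proj₂ (proj₁ (proj₂ (Pairing.bijective π) m))

    ⟨fst,snd⟩ : ∀ m → ⟨ fst m , snd m ⟩ ≡ m
    ⟨fst,snd⟩ m = proj₂ (proj₂ (Pairing.bijective π) m) refl

  ⟨,⟩-injective : ∀ {x y x′ y′} → ⟨ x , y ⟩ ≡ ⟨ x′ , y′ ⟩ → (x , y) ≡ (x′ , y′)
  ⟨,⟩-injective = proj₁ (Pairing.bijective π)

  fst-⟨,⟩ : ∀ x y → fst ⟨ x , y ⟩ ≡ x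
  fst-⟨,⟩ x y = cong proj₁ (⟨,⟩-injective (⟨fst,snd⟩ ⟨ x , y ⟩))

  snd-⟨,⟩ : ∀ x y → snd ⟨ x , y ⟩ ≡ y
  snd-⟨,⟩ x y = cong proj₂ (⟨,⟩-injective (⟨fst,snd⟩ ⟨ x , y ⟩))

  fst≤id : ∀ m → fst m ≤ m
  fst≤id m = ≤-trans (fst≤ (fst m) (snd m)) (≤-reflexive (⟨fst,snd⟩ m))

  snd≤id : ∀ m → snd m ≤ m
  snd≤id m = ≤-trans (snd≤ (fst m) (snd m)) (≤-reflexive (⟨fst,snd⟩ m))

  ‵⟨_,_⟩ : Computable f → Computable g → Computable (λ xs → ⟨ f xs , g xs ⟩)
  ‵⟨_,_⟩ = app₂ ⟨_,_⟩ (Pairing.computable π)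

  -- A search for the least `x` such that some `y ≤ m` gives `⟨ x , y ⟩ ≡ m`, that is, such that the
  -- product of the differences vanishes. The bound on `y` comes from `snd≤`.
  ‵fst : Computable f → Computable (λ xs → fst (f xs))
  ‵fst = app₁ fst (lam₁ (‵μ (λ xs → fst (lookup xs 0F))
      (‵∏< (‵suc (var 1F)) (‵differ ‵⟨ var 1F , var 0F ⟩ (var 2F)))
      (λ { (m ∷ []) i<m → 0<∏< (suc m) λ {y} _ → 0<differ λ eq →
           <⇒≢ i<m (trans (sym (fst-⟨,⟩ _ y)) (cong fst eq)) })
      (λ { (m ∷ []) → ≮0⇒≡0 λ p → n≮0 (subst (0 <_)
           (trans (cong (λ k → differ k m) (⟨fst,snd⟩ m)) (differ-refl m))
           (0<∏<⇒ (suc m) {λ y → differ ⟨ fst m , y ⟩ m} p (s≤s (snd≤id m)))) })))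

  ‵snd : Computable f → Computable (λ xs → snd (f xs))
  ‵snd = app₁ snd (lam₁ (‵μ (λ xs → snd (lookup xs 0F))
      (‵differ ‵⟨ ‵fst (var 1F) , var 0F ⟩ (var 1F))
      (λ { (m ∷ []) i<m → 0<differ λ eq →
           <⇒≢ i<m (trans (sym (snd-⟨,⟩ _ _)) (cong snd eq)) })
      (λ { (m ∷ []) → trans (cong (λ k → differ k m) (⟨fst,snd⟩ m)) (differ-refl m) })))

-- θ x s ≡ suc y says that the computation at x is known, by stage s, to give y.
Monotone : (ℕ → ℕ → ℕ) → Set
Monotone θ = ∀ x s {y} → θ x s ≡ suc y → θ x (suc s) ≡ suc y

-- A stack machine that is universal for the total computable functions.

record UniversalFunction : Set where
  field
    run       : (e x s : ℕ) → ℕ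
    ℛ-run     : ℛ 3 run
    run-mono  : ∀ e → Monotone (run e)
    universal : ∀ {φ} → ℛ 1 φ → ∃[ e ] (∀ x → ∃[ s ] run e x s ≡ suc (φ x))

-- A state ⟨ K , x ⟩ of the machine consists of a value x and a stack K of
-- instructions still to be applied to it; the stack is 0 when empty.
module Machine (π : Pairing) where
  open Pairs π

  push : ℕ → ℕ → ℕ
  push i K = suc ⟨ i , K ⟩

  Zero Suc Fst Snd : ℕ
  Zero = ⟨ 0 , 0 ⟩
  Suc  = ⟨ 1 , 0 ⟩
  Fst  = ⟨ 2 , 0 ⟩
  Snd  = ⟨ 3 , 0 ⟩

  -- `PairWith` and `ConsTo` are never produced by `compile`: they are the frames that `Pair` leaves
  -- on the stack, holding first the saved input and then the first component.
  Comp Pair PairWith : ℕ → ℕ → ℕ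
  Comp f g     = ⟨ 4 , ⟨ f , g ⟩ ⟩
  Pair f g     = ⟨ 5 , ⟨ f , g ⟩ ⟩
  PairWith g x = ⟨ 6 , ⟨ g , x ⟩ ⟩

  ConsTo Loop : ℕ → ℕ
  ConsTo y = ⟨ 7 , y ⟩
  Loop f   = ⟨ 8 , f ⟩

  exec : (tag arg K x : ℕ) → ℕ
  exec t a K x =
    cond  t      ⟨ K , 0 ⟩                                             (
    cond (t ∸ 1) ⟨ K , suc x ⟩                                         (
    cond (t ∸ 2) ⟨ K , fst x ⟩                                         (
    cond (t ∸ 3) ⟨ K , snd x ⟩                                         (
    cond (t ∸ 4) ⟨ push (snd a) (push (fst a) K) , x ⟩                 (
    cond (t ∸ 5) ⟨ push (fst a) (push (PairWith (snd a) x) K) , x ⟩    (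
    cond (t ∸ 6) ⟨ push (fst a) (push (ConsTo x) K) , snd a ⟩          (
    cond (t ∸ 7) ⟨ K , ⟨ a , x ⟩ ⟩                                     (
    cond (fst x) ⟨ K , snd x ⟩
                 ⟨ push a (push (Loop a) K) , ⟨ pred (fst x) , snd x ⟩ ⟩ ))))))))

  step : ℕ → ℕ
  step st = cond (fst st) st
    (exec (fst (fst (pred (fst st)))) (snd (fst (pred (fst st)))) (snd (pred (fst st))) (snd st))

  steps : ℕ → ℕ → ℕ
  steps zero    st = st
  steps (suc s) st = step (steps s st)

  run : (e x s : ℕ) → ℕ
  run e x s = cond (fst (steps s ⟨ push e 0 , x ⟩)) (suc (snd (steps s ⟨ push e 0 , x ⟩))) 0

  ‵push : Computable f → Computable g → Computable (λ xs → push (f xs) (g xs))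
  ‵push cf cg = ‵suc ‵⟨ cf , cg ⟩

  ‵tagged : (t : ℕ) → Computable f → Computable (λ xs → ⟨ t , f xs ⟩)
  ‵tagged t cf = ‵⟨ ‵const t , cf ⟩

  ‵exec : {t a K x : Vec ℕ n → ℕ} →
          Computable t → Computable a → Computable K → Computable x →
          Computable (λ xs → exec (t xs) (a xs) (K xs) (x xs))
  ‵exec {n = n} {t} ct ca cK cx =
    ‵cond ct        ‵⟨ cK , ‵const 0 ⟩                                       (
    ‵cond (minus 1) ‵⟨ cK , ‵suc cx ⟩                                        (
    ‵cond (minus 2) ‵⟨ cK , ‵fst cx ⟩                                        (
    ‵cond (minus 3) ‵⟨ cK , ‵snd cx ⟩                                        (
    ‵cond (minus 4) ‵⟨ ‵push (‵snd ca) (‵push (‵fst ca) cK) , cx ⟩           (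
    ‵cond (minus 5) ‵⟨ ‵push (‵fst ca)
                         (‵push (‵tagged 6 ‵⟨ ‵snd ca , cx ⟩) cK) , cx ⟩     (
    ‵cond (minus 6) ‵⟨ ‵push (‵fst ca) (‵push (‵tagged 7 cx) cK) , ‵snd ca ⟩ (
    ‵cond (minus 7) ‵⟨ cK , ‵⟨ ca , cx ⟩ ⟩                                   (
    ‵cond (‵fst cx) ‵⟨ cK , ‵snd cx ⟩
                    ‵⟨ ‵push ca (‵push (‵tagged 8 ca) cK)
                     , ‵⟨ ‵pred (‵fst cx) , ‵snd cx ⟩ ⟩ ))))))))
    where
    minus : (k : ℕ) → Computable (λ xs → t xs ∸ k)
    minus k = ct ‵∸ ‵const k

  ‵step : Computable f → Computable (λ xs → step (f xs))
  ‵step cf = ‵cond (‵fst cf) cf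
    (‵exec (‵fst (‵fst (‵pred (‵fst cf)))) (‵snd (‵fst (‵pred (‵fst cf))))
           (‵snd (‵pred (‵fst cf))) (‵snd cf))

  ‵steps : Computable f → Computable g → Computable (λ xs → steps (f xs) (g xs))
  ‵steps = app₂ steps (lam₂ (Computable-cong (λ xs → helper (lookup xs 0F) xs)
             (‵recur (var 1F) (‵step (var 1F)) (var 0F))))
    where
    helper : ∀ s (xs : Vec ℕ 2) →
             recur (λ xs → lookup xs 1F) (λ xs → step (lookup xs 1F)) s xs
           ≡ steps s (lookup xs 1F)
    helper zero    xs = refl
    helper (suc s) xs = cong step (helper s xs)

  ℛ-run : ℛ 3 run
  ℛ-run = lam₃ (‵cond (‵fst st) (‵suc (‵snd st)) (‵const 0))
    where
    st : Computable {3} (λ xs →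
           steps (lookup xs 2F) ⟨ push (lookup xs 0F) 0 , lookup xs 1F ⟩)
    st = ‵steps (var 2F) ‵⟨ ‵push (var 0F) (‵const 0) , var 1F ⟩

  step-push : ∀ t a K x → step ⟨ push ⟨ t , a ⟩ K , x ⟩ ≡ exec t a K x
  step-push t a K x
    rewrite fst-⟨,⟩ (push ⟨ t , a ⟩ K) x | snd-⟨,⟩ (push ⟨ t , a ⟩ K) x
          | fst-⟨,⟩ ⟨ t , a ⟩ K | snd-⟨,⟩ ⟨ t , a ⟩ K | fst-⟨,⟩ t a | snd-⟨,⟩ t a = refl

  -- A state with an empty stack is a fixed point of `step`.
  run-mono : ∀ e x s {y} → run e x s ≡ suc y → run e x (suc s) ≡ suc y
  run-mono e x s eq with steps s ⟨ push e 0 , x ⟩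
  ... | st with fst st in q
  ... | zero rewrite q = eq

  infix 4 _⟶_
  infixr 5 _◅◅_

  _⟶_ : ℕ → ℕ → Set
  a ⟶ b = ∃[ s ] steps s a ≡ b

  steps-+ : ∀ s t a → steps (s + t) a ≡ steps s (steps t a)
  steps-+ zero    t a = refl
  steps-+ (suc s) t a = cong step (steps-+ s t a)

  _◅◅_ : ∀ {a b c} → a ⟶ b → b ⟶ c → a ⟶ c
  (s , refl) ◅◅ (t , refl) = t + s , steps-+ t s _

  step⟶ : ∀ t a {K x st} → exec t a K x ≡ st → ⟨ push ⟨ t , a ⟩ K , x ⟩ ⟶ st
  step⟶ t a eq = 1 , trans (step-push t a _ _) eq

  -- The pending instructions `K` are arbitrary, so that runs can be put one after another.
  Runs : (p x y : ℕ) → Set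
  Runs p x y = ∀ K → ⟨ push p K , x ⟩ ⟶ ⟨ K , y ⟩

  runs-Zero : ∀ {x} → Runs Zero x 0
  runs-Zero K = step⟶ 0 0 refl

  runs-Suc : ∀ {x} → Runs Suc x (suc x)
  runs-Suc K = step⟶ 1 0 refl

  runs-Fst : ∀ {x y} → Runs Fst ⟨ x , y ⟩ x
  runs-Fst K = step⟶ 2 0 (cong ⟨ K ,_⟩ (fst-⟨,⟩ _ _))

  runs-Snd : ∀ {x y} → Runs Snd ⟨ x , y ⟩ y
  runs-Snd K = step⟶ 3 0 (cong ⟨ K ,_⟩ (snd-⟨,⟩ _ _))

  runs-Comp : ∀ {p q x y z} → Runs q x y → Runs p y z → Runs (Comp p q) x z
  runs-Comp {p} {q} {x} rq rp K =
    step⟶ 4 ⟨ p , q ⟩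
      (cong₂ (λ u v → ⟨ push u (push v K) , x ⟩) (snd-⟨,⟩ p q) (fst-⟨,⟩ p q))
    ◅◅ rq (push p K) ◅◅ rp K

  runs-Pair : ∀ {p q x y z} → Runs p x y → Runs q x z → Runs (Pair p q) x ⟨ y , z ⟩
  runs-Pair {p} {q} {x} {y} rp rq K =
    step⟶ 5 ⟨ p , q ⟩
      (cong₂ (λ u v → ⟨ push u (push (PairWith v x) K) , x ⟩) (fst-⟨,⟩ p q) (snd-⟨,⟩ p q))
    ◅◅ rp (push (PairWith q x) K)
    ◅◅ step⟶ 6 ⟨ q , x ⟩
         (cong₂ (λ u v → ⟨ push u (push (ConsTo y) K) , v ⟩) (fst-⟨,⟩ q x) (snd-⟨,⟩ q x))
    ◅◅ rq (push (ConsTo y) K)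
    ◅◅ step⟶ 7 y refl

  runs-Loop-0 : ∀ {p x} → Runs (Loop p) ⟨ 0 , x ⟩ x
  runs-Loop-0 {p} {x} K = step⟶ 8 p eq
    where
    eq : exec 8 p K ⟨ 0 , x ⟩ ≡ ⟨ K , x ⟩
    eq rewrite fst-⟨,⟩ 0 x | snd-⟨,⟩ 0 x = refl

  runs-Loop-suc : ∀ {p k x y z} → Runs p ⟨ k , x ⟩ y → Runs (Loop p) y z →
                  Runs (Loop p) ⟨ suc k , x ⟩ z
  runs-Loop-suc {p} {k} {x} rp rl K = step⟶ 8 p eq ◅◅ rp (push (Loop p) K) ◅◅ rl K
    where
    eq : exec 8 p K ⟨ suc k , x ⟩ ≡ ⟨ push p (push (Loop p) K) , ⟨ k , x ⟩ ⟩
    eq rewrite fst-⟨,⟩ (suc k) x | snd-⟨,⟩ (suc k) x = refl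

  Id : ℕ
  Id = Pair Fst Snd

  runs-Id : ∀ {x} → Runs Id x x
  runs-Id {x} = subst (λ w → Runs Id w w) (⟨fst,snd⟩ x) (runs-Pair runs-Fst runs-Snd)

  -- On ⟨ k , ⟨ i , ⟨ r , xs ⟩ ⟩ ⟩ the loop counts k down while i counts up
  -- and r holds the value of the recursion at i.
  PrimRecStep : ℕ → ℕ
  PrimRecStep q =
    Pair Fst (Pair (Comp Suc (Comp Fst Snd))
                   (Pair (Comp q Snd) (Comp Snd (Comp Snd Snd))))

  PrimRec : (p q : ℕ) → ℕ
  PrimRec p q = Comp (Comp Fst Snd)
    (Comp (Loop (PrimRecStep q)) (Pair Fst (Pair Zero (Pair (Comp p Snd) Snd))))

  -- On ⟨ v , ⟨ i , xs ⟩ ⟩ the value v is that of p at ⟨ i , xs ⟩.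
  MinNext : ℕ
  MinNext = Pair (Comp Suc (Comp Fst Snd)) (Comp Snd Snd)

  MinStep Min : ℕ → ℕ
  MinStep p = Pair (Comp p MinNext) MinNext
  Min p = Comp Fst (Comp (Loop (MinStep p))
                         (Pair (Comp p (Pair Zero Id)) (Pair Zero Id)))

  encode : Vec ℕ n → ℕ
  encode []       = 0
  encode (x ∷ xs) = ⟨ x , encode xs ⟩

  compile  : Code n → ℕ
  compiles : ∀ {m} → Vec (Code n) m → ℕ
  compileProj : Fin n → ℕ

  compile zero          = Zero
  compile suc           = Comp Suc Fst
  compile (proj i)      = compileProj i
  compile (comp c ds)   = Comp (compile c) (compiles ds)
  compile (primrec c d) = PrimRec (compile c) (compile d)
  compile (μ c)         = Min (compile c)

  compiles []       = Zero
  compiles (d ∷ ds) = Pair (compile d) (compiles ds)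

  compileProj zero    = Fst
  compileProj (suc i) = Comp (compileProj i) Snd

  Simulates : ℕ → Code n → Set
  Simulates p c = ∀ {xs y} → c [ xs ]⇓ y → Runs p (encode xs) y

  simulates-primrec : ∀ {p q} {c : Code n} {d} → Simulates p c → Simulates q d →
                      Simulates (PrimRec p q) (primrec c d)
  simulates-primrec {p = p} {q} {c} {d} sp sq {k ∷ xs} der =
    let y₀ , rp , rl = loop 0 (+-identityʳ k) der runs-Loop-0 in
    runs-Comp
      (runs-Comp
        (runs-Pair runs-Fst
          (runs-Pair runs-Zero (runs-Pair (runs-Comp runs-Snd rp) runs-Snd)))
        rl)
      (runs-Comp runs-Snd runs-Fst)
    where
    -- A derivation is read from the last recursion step downwards, while the machine counts
    -- upwards. Hence the run is assembled from its end: each `primrecS` puts one more round in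
    -- front of the known rest, until the base value `y₀` is reached.
    loop : ∀ {k xs y w l} j → k + j ≡ l → primrec c d [ k ∷ xs ]⇓ y →
           Runs (Loop (PrimRecStep q)) ⟨ j , ⟨ k , ⟨ y , encode xs ⟩ ⟩ ⟩ w →
           ∃[ y₀ ] Runs p (encode xs) y₀ ×
                   Runs (Loop (PrimRecStep q)) ⟨ l , ⟨ 0 , ⟨ y₀ , encode xs ⟩ ⟩ ⟩ w
    loop j refl (primrec0 der) rl = _ , sp der , rl
    loop {suc k} j eq (primrecS der der′) rl =
      loop (suc j) (trans (+-suc k j) eq) der (runs-Loop-suc
        (runs-Pair runs-Fst
          (runs-Pair (runs-Comp (runs-Comp runs-Snd runs-Fst) runs-Suc)
            (runs-Pair (runs-Comp runs-Snd (sq der′))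
              (runs-Comp (runs-Comp runs-Snd runs-Snd) runs-Snd))))
        rl)

  simulates-μ : ∀ {p} {c : Code (suc n)} → Simulates p c → Simulates (Min p) (μ c)
  simulates-μ {p = p} {c} sp {xs} {y} (μ⇓ below at) =
    let v , rp , rl = loop y 0 (+-identityʳ y) in
    runs-Comp
      (runs-Comp (runs-Pair (runs-Comp ⟨0,xs⟩ rp) ⟨0,xs⟩) rl)
      runs-Fst
    where
    ⟨0,xs⟩ : Runs (Pair Zero Id) (encode xs) ⟨ 0 , encode xs ⟩
    ⟨0,xs⟩ = runs-Pair runs-Zero runs-Id

    loop : ∀ d i → d + i ≡ y → ∃[ v ] Runs p ⟨ i , encode xs ⟩ v ×
             Runs (Loop (MinStep p)) ⟨ v , ⟨ i , encode xs ⟩ ⟩ ⟨ y , encode xs ⟩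
    loop zero    i refl = 0 , sp at , runs-Loop-0
    loop (suc d) i refl
      with k , der ← below {i} (s≤s (m≤n+m i d))
         | v , rp , rl ← loop d (suc i) (+-suc d i) =
      suc k , sp der , runs-Loop-suc (runs-Pair (runs-Comp next rp) next) rl
      where
      next : ∀ {k i x} → Runs MinNext ⟨ k , ⟨ i , x ⟩ ⟩ ⟨ suc i , x ⟩
      next = runs-Pair (runs-Comp (runs-Comp runs-Snd runs-Fst) runs-Suc)
                       (runs-Comp runs-Snd runs-Snd)

  simulates-proj : (i : Fin n) → Simulates (compileProj i) (proj i)
  simulates-proj zero    {_ ∷ _} proj⇓ = runs-Fst
  simulates-proj (suc i) {_ ∷ xs} proj⇓ =
    runs-Comp runs-Snd (simulates-proj i {xs} proj⇓)

  simulates : (c : Code n) → Simulates (compile c) c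
  simulates-vec : ∀ {m} (ds : Vec (Code n) m) {xs ys} →
                  Pointwise (λ d y → d [ xs ]⇓ y) ds ys →
                  Runs (compiles ds) (encode xs) (encode ys)

  simulates zero          zero⇓           = runs-Zero
  simulates suc           suc⇓            = runs-Comp runs-Fst runs-Suc
  simulates (proj i)      der             = simulates-proj i der
  simulates (comp c ds)   (comp⇓ ders der) =
    runs-Comp (simulates-vec ds ders) (simulates c der)
  simulates (primrec c d) der             =
    simulates-primrec {c = c} {d} (simulates c) (simulates d) der
  simulates (μ c)         der             = simulates-μ {c = c} (simulates c) der

  simulates-vec []       []           = runs-Zero
  simulates-vec (d ∷ ds) (der ∷ ders) = runs-Pair (simulates d der) (simulates-vec ds ders)

  universal : ∀ {φ} → ℛ 1 φ → ∃[ e ] (∀ x → ∃[ s ] run e x s ≡ suc (φ x))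
  -- `Pair Id Zero` turns the bare input `x` into `encode (x ∷ [])`.
  universal {φ} (c , ok) = Comp (compile c) (Pair Id Zero) , runs
    where
    runs : ∀ x → ∃[ s ] run (Comp (compile c) (Pair Id Zero)) x s ≡ suc (φ x)
    runs x with s , eq ← runs-Comp (runs-Pair runs-Id runs-Zero)
                                   (simulates c (ok (x ∷ []))) 0
           = s , halted
      where
      halted : run (Comp (compile c) (Pair Id Zero)) x s ≡ suc (φ x)
      halted rewrite eq | fst-⟨,⟩ 0 (φ x) | snd-⟨,⟩ 0 (φ x) = refl

universalFunction : Pairing → UniversalFunction
universalFunction π = record
  { run = run ; ℛ-run = ℛ-run ; run-mono = run-mono ; universal = universal }
  where open Machine π

-- Partial functions as limits of monotone approximations.

cond-suc : ∀ a {b y} → cond a 0 b ≡ suc y → 0 < a × b ≡ suc y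
cond-suc (suc a) eq = z<s , eq

cond-pos : ∀ {a b c} → 0 < a → cond a b c ≡ c
cond-pos {suc a} _ = refl

≡suc⇒0< : ∀ {m y} → m ≡ suc y → 0 < m
≡suc⇒0< refl = z<s

0<⇒≡suc : ∀ {m} → 0 < m → ∃[ y ] m ≡ suc y
0<⇒≡suc {suc y} _ = y , refl

0<∸⇒< : ∀ {m n} → 0 < m ∸ n → n < m
0<∸⇒< {m} {n} p = m∸n≢0⇒n<m (λ eq → <⇒≢ p (sym eq))

Converges : (ℕ → ℕ → ℕ) → ℕ → Set
Converges θ x = ∃[ s ] 0 < θ x s

module _ {θ : ℕ → ℕ → ℕ} (mono : Monotone θ) where

  persists : ∀ {x s t y} → s ≤ t → θ x s ≡ suc y → θ x t ≡ suc y
  persists = go ∘ ≤⇒≤′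
    where
    go : ∀ {x s t y} → s ≤′ t → θ x s ≡ suc y → θ x t ≡ suc y
    go (≤′-reflexive refl) eq = eq
    go (≤′-step s≤t)       eq = mono _ _ (go s≤t eq)

  persists⁺ : ∀ {x s t} → s ≤ t → 0 < θ x s → 0 < θ x t
  persists⁺ s≤t p = ≡suc⇒0< (persists s≤t (proj₂ (0<⇒≡suc p)))

  limit : PartialFunction
  limit = record
    { _↦_        = λ x y → ∃[ s ] θ x s ≡ suc y
    ; functional = λ { (s , p) (t , q) → suc-injective
        (trans (sym (persists (m≤m⊔n s t) p)) (persists (m≤n⊔m s t) q)) }
    }

  Dom⇒Converges : ∀ {x} → Dom limit x → Converges θ x
  Dom⇒Converges (_ , s , eq) = s , ≡suc⇒0< eq

  Converges⇒Dom : ∀ {x} → Converges θ x → Dom limit x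
  Converges⇒Dom (s , p) = proj₁ (0<⇒≡suc p) , s , proj₂ (0<⇒≡suc p)

  uniform-stage : ∀ a → (∀ {z} → z < a → Converges θ z) →
                  ∃[ s ] (∀ {z} → z < a → 0 < θ z s)
  uniform-stage zero    conv = 0 , λ ()
  uniform-stage (suc a) conv
    with s , p ← conv {a} ≤-refl | t , q ← uniform-stage a (conv ∘ m<n⇒m<1+n)
    = s ⊔ t , λ z<1+a → [ (λ z<a → persists⁺ (m≤n⊔m s t) (q z<a))
                        , (λ { refl → persists⁺ (m≤m⊔n s t) p }) ]′ (m<1+n⇒m<n∨m≡n z<1+a)

  total⇒ℛ¹ : ℛ 2 θ → (∀ x → Converges θ x) → ℛ¹ limit
  total⇒ℛ¹ cθ total =
    (λ x → pred (θ x (first x))) ,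
    lam₁ (‵pred (app₂ θ cθ (var 0F) (app₁ first ℛ-first (var 0F)))) ,
    λ x y → mk⇔
      (λ graph-xy → PartialFunction.functional limit (value x) graph-xy)
      (λ { refl → value x })
    where
    least : (f : ℕ → ℕ) → ∀ s → 0 < f s → ∃[ m ] 0 < f m × (∀ {i} → i < m → f i ≡ 0)
    least f s       p with f 0 in eq
    least f s       p | suc _ = 0 , ≡suc⇒0< eq , λ ()
    least f zero    p | zero  = ⊥-elim (<⇒≢ p (sym eq))
    least f (suc s) p | zero with m , q , below ← least (f ∘ suc) s p =
      suc m , q , λ { {zero} _ → eq ; {suc i} i<m → below (s≤s⁻¹ i<m) }

    first : ℕ → ℕ
    first x = proj₁ (least (θ x) _ (proj₂ (total x)))

    first-converges : ∀ x → 0 < θ x (first x)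
    first-converges x = proj₁ (proj₂ (least (θ x) _ (proj₂ (total x))))

    ℛ-first : ℛ 1 first
    ℛ-first = lam₁ (‵μ (λ xs → first (lookup xs 0F))
      (‵cond (app₂ θ cθ (var 1F) (var 0F)) (‵const 1) (‵const 0))
      (λ { (x ∷ []) i<m → subst (λ v → 0 < cond v 1 0)
             (sym (proj₂ (proj₂ (least (θ x) _ (proj₂ (total x)))) i<m)) z<s })
      (λ { (x ∷ []) → cond-pos (first-converges x) }))

    value : ∀ x → graph limit x (pred (θ x (first x)))
    value x = first x , sym (suc-pred _ {{>-nonZero (first-converges x)}})

limit-cong : ∀ {θ θ′} (mono : Monotone θ) (mono′ : Monotone θ′) →
             (∀ x s → θ x s ≡ θ′ x s) → limit mono ≐ limit mono′
limit-cong mono mono′ eq x y =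
  mk⇔ (λ (s , p) → s , trans (sym (eq x s)) p) (λ (s , p) → s , trans (eq x s) p)

-- Finitely many values can be written into the program itself, however they were obtained; from `a`
-- onwards the table continues with `0`.
finite-table : ∀ a (R : ℕ → ℕ → Set) → (∀ {x} → x < a → ∃[ y ] R x y) →
               ∃[ φ ] ℛ 1 φ × (∀ {x} → x < a → R x (φ x))
finite-table zero    R total = (λ _ → 0) , lam₁ (‵const 0) , λ ()
finite-table (suc a) R total
  with φ , cφ , ok ← finite-table a (R ∘ suc) (total ∘ s<s) | y , Ry ← total {0} z<s =
  (λ x → cond x y (φ (pred x))) ,
  lam₁ (‵cond (var 0F) (‵const y) (app₁ φ cφ (‵pred (var 0F)))) ,
  λ { {zero} _ → Ry ; {suc x} x<a → ok (s<s⁻¹ x<a) }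

-- Unions of initial segments.

module Classical (em : ∀ {ℓ} → ExcludedMiddle ℓ) where

  maximum : (P : ℕ → Set) → ∀ N → (∀ {a} → P a → a ≤ N) → ∃[ a ] P a →
            ∃[ m ] P m × (∀ {a} → P a → a ≤ m)
  maximum P zero    bound (a , Pa) = a , Pa , λ Pb → ≤-trans (bound Pb) z≤n
  maximum P (suc N) bound ∃P with em {P = P (suc N)}
  ... | yes PN = suc N , PN , bound
  ... | no ¬PN = maximum P N
        (λ Pa → s≤s⁻¹ (≤∧≢⇒< (bound Pa) λ { refl → ¬PN Pa })) ∃P

  infinite⇒unbounded : ∀ {A} → Infinite A → ∀ x → ∃[ a ] A a × x < a
  infinite⇒unbounded {A} inf x with em {P = ∃[ a ] A a × x < a}
  ... | yes p = p
  ... | no ¬p = contradiction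
        (upTo (suc x) , λ a Aa → ∈-upTo⁺ (s≤s (≮⇒≥ λ x<a → ¬p (a , Aa , x<a)))) inf

  -- A point missing from `D` bounds the length of every segment inside `D`. So, unless `D` is
  -- empty, there is a longest one with length in `A`, and the segment around any point of `D` is no
  -- longer than it.
  union-of-segments : ∀ (A D : Pred ℕ 0ℓ) →
    (∀ {x} → D x → ∃[ a ] A a × x < a × (∀ {z} → z < a → D z)) →
    (∀ x → D x) ⊎ (∀ x → ¬ D x) ⊎ (∃[ a ] A a × (∀ x → D x ⇔ x < a))
  union-of-segments A D segment with em {P = ∃[ x ] ¬ D x} | em {P = ∃[ x ] D x}
  ... | no ¬∃ | _ = inj₁ λ x → [ id , (λ ¬Dx → contradiction (x , ¬Dx) ¬∃) ]′ (toSum em)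
  ... | yes _ | no ¬∃ = inj₂ (inj₁ λ x Dx → ¬∃ (x , Dx))
  ... | yes (x₀ , ¬Dx₀) | yes (x₁ , Dx₁)
    with a₁ , Aa₁ , _ , below₁ ← segment Dx₁
    with a , (Aa , below) , greatest ←
           maximum (λ a → A a × (∀ {z} → z < a → D z)) x₀
                   (λ (_ , below) → ≮⇒≥ λ x₀<a → ¬Dx₀ (below x₀<a)) (a₁ , Aa₁ , below₁) =
    inj₂ (inj₂ (a , Aa , λ x → mk⇔
      (λ Dx → let b , Ab , x<b , below-b = segment Dx in <-≤-trans x<b (greatest (Ab , below-b)))
      below))

-- The numberings `η b`.

module Numbering
  (em : ∀ {ℓ} → ExcludedMiddle ℓ) (π : Pairing) (U : UniversalFunction)
  (A : Pred ℕ 0ℓ)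
  (α : ℕ → ℕ) (ℛ-α : ℛ 1 α) (range-α : IsRangeOf A α)
  (unbounded : ∀ x → ∃[ t ] x < α t)
  where

  open Pairs π
  open UniversalFunction U
  open Classical em

  A-α : ∀ t → A (α t)
  A-α t = Equivalence.from (range-α (α t)) (t , refl)

  -- `α t₀` is a positive member of `A`. It is the length of all the constant segments, which are
  -- therefore defined at `0`.
  t₀ : ℕ
  t₀ = proj₁ (unbounded 0)

  constant : (v x : ℕ) → ℕ
  constant v x = cond (α t₀ ∸ x) 0 (suc v)

  allowed : (b x : ℕ) → ℕ
  allowed b x = cond b 1 (α (pred b) ∸ x)

  -- For p = ⟨ e , b ⟩, the program e cut off at α u if b = suc u, so that a finite
  -- function is obtained without a program proved to diverge.
  cutRun : (p x s : ℕ) → ℕ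
  cutRun p x s = cond (allowed (snd p) x) 0 (run (fst p) x s)

  segmentFound : (p x s : ℕ) → ℕ
  segmentFound p x s = ∑< s λ t → (α t ∸ x) * ∏< (α t) (λ z → cutRun p z s)

  segmented : (p x s : ℕ) → ℕ
  segmented p x s = cond (segmentFound p x s) 0 (cutRun p x s)

  -- The stage t certifies that the function is nonempty; without this
  -- certificate a default function is used, so that the value is never empty.
  base : (t p x s : ℕ) → ℕ
  base t p x s = cond (segmented p 0 t) (constant 0 x) (segmented p x s)

  outputsSpecial : (e n s : ℕ) → ℕ
  outputsSpecial e n s = cond (run e n s) 0 (cond (fst (pred (run e n s))) 1 0)

  special : (b : ℕ → ℕ) (n x s : ℕ) → ℕ
  special b n x s = cond (b (fst (snd n))) 0
    (cond (outputsSpecial (snd (snd n)) n s) 0 (constant (snd n) x))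

  ν : (b : ℕ → ℕ) (n x s : ℕ) → ℕ
  ν b n x s = cond (fst n) (special b n x s) (base (pred (fst n)) (snd n) x s)

  ‵α : Computable f → Computable (λ xs → α (f xs))
  ‵α = app₁ α ℛ-α

  ‵run : Computable f → Computable g → Computable h →
         Computable (λ xs → run (f xs) (g xs) (h xs))
  ‵run = app₃ run ℛ-run

  ‵constant : Computable f → Computable g → Computable (λ xs → constant (f xs) (g xs))
  ‵constant cv cx = ‵cond (‵α (‵const t₀) ‵∸ cx) (‵const 0) (‵suc cv)

  ‵cutRun : Computable f → Computable g → Computable h →
            Computable (λ xs → cutRun (f xs) (g xs) (h xs))
  ‵cutRun cp cx cs =
    ‵cond (‵cond (‵snd cp) (‵const 1) (‵α (‵pred (‵snd cp)) ‵∸ cx)) (‵const 0)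
          (‵run (‵fst cp) cx cs)

  ‵segmented : Computable f → Computable g → Computable h →
               Computable (λ xs → segmented (f xs) (g xs) (h xs))
  ‵segmented = app₃ segmented (lam₃ (‵cond
    (‵∑< (var 2F) ((‵α (var 0F) ‵∸ var 2F) ‵*
                   ‵∏< (‵α (var 0F)) (‵cutRun (var 2F) (var 0F) (var (suc 3F)))))
    (‵const 0)
    (‵cutRun (var 0F) (var 1F) (var 2F))))

  ℛ-ν : ∀ {b} → ℛ 1 b → ℛ 3 (ν b)
  ℛ-ν {b} ℛ-b = lam₃ (‵cond (‵fst i)
    (‵cond (app₁ b ℛ-b (‵fst (‵snd i))) (‵const 0)
      (‵cond (‵cond run′ (‵const 0) (‵cond (‵fst (‵pred run′)) (‵const 1) (‵const 0)))
        (‵const 0) (‵constant (‵snd i) x)))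
    (‵cond (‵segmented (‵snd i) (‵const 0) (‵pred (‵fst i)))
      (‵constant (‵const 0) x) (‵segmented (‵snd i) x s)))
    where
    i x s : Computable {3} _
    i = var 0F
    x = var 1F
    s = var 2F
    run′ = ‵run (‵snd (‵snd i)) i s

  constant-suc : ∀ {v x y} → constant v x ≡ suc y → x < α t₀ × v ≡ y
  constant-suc {x = x} eq = let p , q = cond-suc (α t₀ ∸ x) eq in 0<∸⇒< p , suc-injective q

  constant-defined : ∀ {v x} → x < α t₀ → constant v x ≡ suc v
  constant-defined x<αt₀ = cond-pos (m<n⇒0<n∸m x<αt₀)

  cutRun-mono : ∀ p → Monotone (cutRun p)
  cutRun-mono p x s eq with q , r ← cond-suc (allowed (snd p) x) eq =
    trans (cond-pos q) (run-mono (fst p) x s r)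

  segmentFound⇒ : ∀ {p x s} → 0 < segmentFound p x s →
    ∃[ t ] t < s × x < α t × (∀ {z} → z < α t → 0 < cutRun p z s)
  segmentFound⇒ {p} {x} {s} q
    with t , t<s , r ← 0<∑<⇒ s {λ t → (α t ∸ x) * ∏< (α t) (λ z → cutRun p z s)} q
    with r₁ , r₂ ← 0<*⇒ (α t ∸ x) r = t , t<s , 0<∸⇒< r₁ , 0<∏<⇒ (α t) r₂

  ⇒segmentFound : ∀ {p x s t} → t < s → x < α t → (∀ {z} → z < α t → 0 < cutRun p z s) →
    0 < segmentFound p x s
  ⇒segmentFound t<s x<αt q = 0<∑< _ t<s (*-mono-< (m<n⇒0<n∸m x<αt) (0<∏< _ q))

  ⇒segmented : ∀ {p x s t} → t < s → x < α t → (∀ {z} → z < α t → 0 < cutRun p z s) →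
    0 < segmented p x s
  ⇒segmented {p} {x} {s} t<s x<αt q =
    subst (0 <_) (sym (cond-pos (⇒segmentFound {p} t<s x<αt q))) (q x<αt)

  segmented-mono : ∀ p → Monotone (segmented p)
  segmented-mono p x s eq
    with q , r ← cond-suc (segmentFound p x s) eq
    with t , t<s , x<αt , below ← segmentFound⇒ {p} {x} {s} q =
    trans (cond-pos (⇒segmentFound {p} (m<n⇒m<1+n t<s) x<αt
                      (λ z<αt → persists⁺ (cutRun-mono p) (n≤1+n s) (below z<αt))))
          (cutRun-mono p x s r)

  -- The choice between the default and the program is made at the stage `t` stored in the index, so
  -- it is not revised as `s` grows. Testing the point `0` is enough, because a nonempty union of
  -- initial segments contains `0`.
  base-mono : ∀ t p → Monotone (base t p)
  base-mono t p x s eq with segmented p 0 t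
  ... | zero  = eq
  ... | suc _ = segmented-mono p x s eq

  outputsSpecial⇒ : ∀ {e n s} → 0 < outputsSpecial e n s →
                    ∃[ j ] run e n s ≡ suc j × fst j ≡ 0
  outputsSpecial⇒ {e} {n} {s} q with run e n s
  ... | suc j with fst j in eq
  ...   | zero = j , refl , eq

  ⇒outputsSpecial : ∀ {e n s j} → run e n s ≡ suc j → fst j ≡ 0 → 0 < outputsSpecial e n s
  ⇒outputsSpecial eq fst≡0 rewrite eq | fst≡0 = z<s

  special⇒ : ∀ {b n x s y} → special b n x s ≡ suc y →
    0 < b (fst (snd n)) × 0 < outputsSpecial (snd (snd n)) n s × x < α t₀ × snd n ≡ y
  special⇒ {b} {n} {x} {s} eq =
    let p , eq′ = cond-suc (b (fst (snd n))) eq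
        q , eq″ = cond-suc (outputsSpecial (snd (snd n)) n s) eq′
        x<αt₀ , r = constant-suc eq″
    in p , q , x<αt₀ , r

  ⇒special : ∀ b {n x s} → 0 < b (fst (snd n)) → 0 < outputsSpecial (snd (snd n)) n s →
             x < α t₀ → special b n x s ≡ suc (snd n)
  ⇒special _ p q x<αt₀ = trans (cond-pos p) (trans (cond-pos q) (constant-defined x<αt₀))

  special-mono : ∀ b n → Monotone (special b n)
  special-mono b n x s eq
    with p , q , x<αt₀ , refl ← special⇒ {b} {n} {x} {s} eq
    with j , r , fst≡0 ← outputsSpecial⇒ {snd (snd n)} {n} {s} q =
    ⇒special b p (⇒outputsSpecial (run-mono (snd (snd n)) n s r) fst≡0) x<αt₀

  ν-mono : ∀ b n → Monotone (ν b n)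
  ν-mono b n x s eq with fst n
  ... | zero  = special-mono b n x s eq
  ... | suc t = base-mono t (snd n) x s eq

  ν-special : ∀ {b n x s} → fst n ≡ 0 → ν b n x s ≡ special b n x s
  ν-special eq rewrite eq = refl

  ν-base : ∀ {b n x s t} → fst n ≡ suc t → ν b n x s ≡ base t (snd n) x s
  ν-base eq rewrite eq = refl

  η : (ℕ → ℕ) → ℕ → PartialFunction
  η b n = limit (ν-mono b n)

  Segmental : (ℕ → ℕ → ℕ) → Set
  Segmental θ = ∀ {x} → Converges θ x →
    ∃[ a ] A a × x < a × (∀ {z} → z < a → Converges θ z)

  constant-segmental : ∀ v → Segmental (λ x _ → constant v x)
  constant-segmental v (_ , p) =
    α t₀ , A-α t₀ , proj₁ (constant-suc (proj₂ (0<⇒≡suc p))) ,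
    λ z<αt₀ → 0 , ≡suc⇒0< (constant-defined z<αt₀)

  segmented-segmental : ∀ p → Segmental (segmented p)
  segmented-segmental p {x} (s , q)
    with _ , eq ← 0<⇒≡suc q
    with t , t<s , x<αt , below ← segmentFound⇒ {p} {x} {s} (proj₁ (cond-suc (segmentFound p x s) eq)) =
    α t , A-α t , x<αt , λ z<αt → s , ⇒segmented {p} t<s z<αt below

  base-segmental : ∀ t p → Segmental (base t p)
  base-segmental t p with segmented p 0 t
  ... | zero  = constant-segmental 0
  ... | suc _ = segmented-segmental p

  special-segmental : ∀ b n → Segmental (special b n)
  special-segmental b n {x} (s , q)
    with p , r , x<αt₀ , _ ← special⇒ {b} {n} {x} {s} (proj₂ (0<⇒≡suc q)) =
    α t₀ , A-α t₀ , x<αt₀ , λ z<αt₀ → s , ≡suc⇒0< (⇒special b {n} p r z<αt₀)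

  ν-segmental : ∀ b n → Segmental (ν b n)
  ν-segmental b n with fst n
  ... | zero  = special-segmental b n
  ... | suc t = base-segmental t (snd n)

  -- The bounds on the projections make `0` equal to `⟨ 0 , ⟨ 0 , 0 ⟩ ⟩`, a special index with `k`
  -- equal to `0`. Keeping `0` out of every `b` reserves one index for the empty function in all the
  -- numberings, to which a reduction can send inactive indices.
  ν-0 : ∀ b → b 0 ≡ 0 → ∀ x s → ν b 0 x s ≡ 0
  ν-0 b b0≡0 x s
    rewrite n≤0⇒n≡0 (fst≤id 0) | n≤0⇒n≡0 (snd≤id 0) | n≤0⇒n≡0 (fst≤id 0) | b0≡0 = refl

  -- Each `η b` is a computable numbering of `𝒮 A`.

  module _ {b : ℕ → ℕ} (ℛ-b : ℛ 1 b) (b0≡0 : b 0 ≡ 0) where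

    η∈𝒮 : ∀ n → 𝒮 A (η b n)
    η∈𝒮 n with union-of-segments A (Converges (ν b n)) (ν-segmental b n)
    ... | inj₁ total = inj₁ (total⇒ℛ¹ (ν-mono b n)
            (lam₂ (app₃ (ν b) (ℛ-ν ℛ-b) (‵const n) (var 0F) (var 1F))) total)
    ... | inj₂ (inj₁ empty) =
            inj₂ (inj₁ λ x Dx → empty x (Dom⇒Converges (ν-mono b n) Dx))
    ... | inj₂ (inj₂ (a , Aa , dom)) = inj₂ (inj₂ (a , Aa , λ x → mk⇔
            (Equivalence.to (dom x) ∘ Dom⇒Converges (ν-mono b n))
            (Converges⇒Dom (ν-mono b n) ∘ Equivalence.from (dom x))))

    empty-indexed : ∀ f → (∀ x → ¬ Dom f x) → ∃[ n ] η b n ≐ f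
    empty-indexed f empty = 0 , λ x y → mk⇔
      (λ (s , eq) → contradiction (trans (sym eq) (ν-0 b b0≡0 x s)) λ ())
      (λ fxy → contradiction (y , fxy) (empty x))

    -- Treats total and nonempty finite functions together. As the allowed points form a union of
    -- segments with lengths in `A`, waiting for whole segments loses none of the values.
    cut-indexed : ∀ f φ → ℛ 1 φ → ∀ u → 0 < allowed u 0 →
      (∀ {x} → 0 < allowed u x → ∃[ t ] x < α t × (∀ {z} → z < α t → 0 < allowed u z)) →
      (∀ {x y} → graph f x y ⇔ (φ x ≡ y × 0 < allowed u x)) → ∃[ n ] η b n ≐ f
    cut-indexed f φ ℛ-φ u nonempty segment graph-f = ⟨ suc t₁ , p ⟩ , λ x y → mk⇔
      (λ (s , eq) → Equivalence.from graph-f (sound x s (trans (sym (ν-eq x s)) eq)))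
      (λ fxy → let eq , a = Equivalence.to graph-f fxy
                   s , q  = complete a
                   y′ , r = 0<⇒≡suc q
               in s , trans (ν-eq x s) (trans r (cong suc (trans (sym (proj₁ (sound x s r))) eq))))
      where
      e p : ℕ
      e = proj₁ (universal ℛ-φ)
      p = ⟨ e , u ⟩

      runs : ∀ x → ∃[ s ] run e x s ≡ suc (φ x)
      runs = proj₂ (universal ℛ-φ)

      cutRun-p : ∀ {x s} → cutRun p x s ≡ cond (allowed u x) 0 (run e x s)
      cutRun-p rewrite fst-⟨,⟩ e u | snd-⟨,⟩ e u = refl

      sound : ∀ x s {y} → segmented p x s ≡ suc y → φ x ≡ y × 0 < allowed u x
      sound x s eq
        with a , r ← cond-suc (allowed u x)
               (trans (sym (cutRun-p {x} {s})) (proj₂ (cond-suc (segmentFound p x s) eq))) =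
        PartialFunction.functional (limit {θ = run e} (run-mono e)) (runs x) (s , r) , a

      cutRun-converges : ∀ {x} → 0 < allowed u x → Converges (cutRun p) x
      cutRun-converges {x} a with s , r ← runs x =
        s , subst (0 <_) (sym (trans (cutRun-p {x} {s}) (cond-pos a))) (≡suc⇒0< r)

      complete : ∀ {x} → 0 < allowed u x → Converges (segmented p) x
      complete a
        with t , x<αt , below ← segment a
        with s , q ← uniform-stage (cutRun-mono p) (α t) (cutRun-converges ∘ below) =
        s ⊔ suc t , ⇒segmented {p} (m≤n⊔m s (suc t)) x<αt
                      (λ z<αt → persists⁺ (cutRun-mono p) (m≤m⊔n s (suc t)) (q z<αt))

      -- A stage at which the value at `0` has been released: stored in the index, it rules out the
      -- default.
      t₁ : ℕ
      t₁ = proj₁ (complete nonempty)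

      ν-eq : ∀ x s → ν b ⟨ suc t₁ , p ⟩ x s ≡ segmented p x s
      ν-eq x s = trans (ν-base {b} (fst-⟨,⟩ (suc t₁) p))
        (trans (cong (λ p → base t₁ p x s) (snd-⟨,⟩ (suc t₁) p))
               (cond-pos (proj₂ (complete nonempty))))

    𝒮⇒η : ∀ f → 𝒮 A f → ∃[ n ] η b n ≐ f
    𝒮⇒η f (inj₁ (φ , ℛ-φ , graph-f)) =
      -- Without a cut, every `x` lies in some segment because `A` is unbounded.
      cut-indexed f φ ℛ-φ 0 z<s (λ {x} _ → let t , x<αt = unbounded x in t , x<αt , λ _ → z<s)
        λ {x} {y} → mk⇔ (λ fxy → Equivalence.to (graph-f x y) fxy , z<s)
                        (λ (eq , _) → Equivalence.from (graph-f x y) eq)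
    𝒮⇒η f (inj₂ (inj₁ empty)) = empty-indexed f empty
    𝒮⇒η f (inj₂ (inj₂ (a , Aa , dom)))
      with u , refl ← Equivalence.to (range-α a) Aa
      -- `A` may contain `0`, whose segment is the empty function and so has no base index.
      with 0 <? α u
    ... | no ¬0<a = empty-indexed f λ x Dx → ¬0<a (≤-<-trans z≤n (Equivalence.to (dom x) Dx))
    ... | yes 0<a with φ , ℛ-φ , ok ← finite-table (α u) (graph f) (Equivalence.from (dom _)) =
      cut-indexed f φ ℛ-φ (suc u) (m<n⇒0<n∸m 0<a)
        (λ x<a → u , 0<∸⇒< x<a , m<n⇒0<n∸m)
        λ {x} {y} → mk⇔
          (λ fxy → let x<a = Equivalence.to (dom x) (y , fxy)
                   in PartialFunction.functional f (ok x<a) fxy , m<n⇒0<n∸m x<a)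
          (λ { (refl , x<a) → ok (0<∸⇒< x<a) })

    -- An argument `⟨ ⟨ i , x ⟩ , suc s ⟩` lists the state of the computation at stage `s`. The
    -- approximation is `0` or `suc y`, just as in the extended graph, so an unfinished computation
    -- merely repeats the entry for `0`.
    tabulated : ℕ → ℕ
    tabulated m = ⟨ fst m , cond (snd m) 0 (ν b (fst (fst m)) (snd (fst m)) (pred (snd m))) ⟩

    ℛ-tabulated : ℛ 1 tabulated
    ℛ-tabulated = lam₁ ‵⟨ ‵fst m , ‵cond (‵snd m) (‵const 0)
      (app₃ (ν b) (ℛ-ν ℛ-b) (‵fst (‵fst m)) (‵snd (‵fst m)) (‵pred (‵snd m))) ⟩
      where
      m : Computable {1} _
      m = var 0F

    tabulated-0 : ∀ i x → tabulated ⟨ ⟨ i , x ⟩ , 0 ⟩ ≡ ⟨ ⟨ i , x ⟩ , 0 ⟩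
    tabulated-0 i x rewrite fst-⟨,⟩ ⟨ i , x ⟩ 0 | snd-⟨,⟩ ⟨ i , x ⟩ 0 = refl

    tabulated-suc : ∀ i x s → tabulated ⟨ ⟨ i , x ⟩ , suc s ⟩ ≡ ⟨ ⟨ i , x ⟩ , ν b i x s ⟩
    tabulated-suc i x s
      rewrite fst-⟨,⟩ ⟨ i , x ⟩ (suc s) | snd-⟨,⟩ ⟨ i , x ⟩ (suc s)
            | fst-⟨,⟩ i x | snd-⟨,⟩ i x = refl

    range-tabulated : IsRangeOf (ExtendedGraph π (η b)) tabulated
    range-tabulated y = mk⇔
      (λ { (inj₁ (i , x , refl))                 → _ , tabulated-0 i x
         ; (inj₂ (i , x , y , (s , eq) , refl)) →
             _ , trans (tabulated-suc i x s) (cong ⟨ ⟨ i , x ⟩ ,_⟩ eq) })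
      (λ { (m , refl) → listed m })
      where
      listed : ∀ m → ExtendedGraph π (η b) (tabulated m)
      listed m with cond (snd m) 0 (ν b (fst (fst m)) (snd (fst m)) (pred (snd m))) in eq
      ... | zero  = inj₁ (fst (fst m) , snd (fst m) , cong ⟨_, 0 ⟩ (sym (⟨fst,snd⟩ (fst m))))
      ... | suc y = inj₂ (fst (fst m) , snd (fst m) , y , (pred (snd m) , proj₂ (cond-suc (snd m) eq)) ,
                          cong ⟨_, suc y ⟩ (sym (⟨fst,snd⟩ (fst m))))

    numbering : BN π A
    numbering = record
      { η            = η b
      ; isNumbering  = η∈𝒮 , 𝒮⇒η
      ; isComputable = tabulated , ℛ-tabulated , range-tabulated
      }

  -- Reducibility and inclusion.

  -- The set `b` only switches special indices on or off. An index that is active for both sets has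
  -- the same function, so the identity works except at indices inactive for `b`, which go to `0`.
  ⊆⇒≤ₘ : ∀ {b b′} → ℛ 1 b → b′ 0 ≡ 0 → (∀ {k} → 0 < b k → 0 < b′ k) → η b ≤ₘ η b′
  ⊆⇒≤ₘ {b} {b′} ℛ-b b′0≡0 b⊆b′ =
    reduce ,
    lam₁ (‵cond (‵fst (var 0F))
      (‵cond (app₁ b ℛ-b (‵fst (‵snd (var 0F)))) (‵const 0) (var 0F)) (var 0F)) ,
    λ n → limit-cong (ν-mono b n) (ν-mono b′ (reduce n)) (ν-reduce n)
    where
    reduce : ℕ → ℕ
    reduce n = cond (fst n) (cond (b (fst (snd n))) 0 n) n

    ν-reduce : ∀ n x s → ν b n x s ≡ ν b′ (reduce n) x s
    ν-reduce n x s with fst n in fst-n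
    ... | suc t = sym (ν-base {b′} {n} fst-n)
    ... | zero with b (fst (snd n)) in b-eq
    ...   | zero  = sym (ν-0 b′ b′0≡0 x s)
    ...   | suc _ = sym (trans (ν-special {b′} {n} fst-n) (cond-pos (b⊆b′ (≡suc⇒0< b-eq))))

  base-converges : ∀ t p → Converges (base t p) 0
  base-converges t p with segmented p 0 t in eq
  ... | zero  = 0 , ≡suc⇒0< (constant-defined (proj₂ (unbounded 0)))
  ... | suc _ = t , ≡suc⇒0< eq

  ⊈⇒≰ₘ : ∀ {b b′ k} → 0 < b k → b′ k ≡ 0 → ¬ η b ≤ₘ η b′
  ⊈⇒≰ₘ {b} {b′} {k} k∈b k∉b′ (φ , ℛ-φ , reduces) = diagonal (fst (φ i)) refl
    where
    e i : ℕ
    e = proj₁ (universal ℛ-φ)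
    i = ⟨ 0 , ⟨ k , e ⟩ ⟩

    fst-i : fst i ≡ 0
    fst-i = fst-⟨,⟩ 0 ⟨ k , e ⟩

    k-i : fst (snd i) ≡ k
    k-i = trans (cong fst (snd-⟨,⟩ 0 ⟨ k , e ⟩)) (fst-⟨,⟩ k e)

    e-i : snd (snd i) ≡ e
    e-i = trans (cong snd (snd-⟨,⟩ 0 ⟨ k , e ⟩)) (snd-⟨,⟩ k e)

    output : ∃[ s ] run (snd (snd i)) i s ≡ suc (φ i)
    output with s , eq ← proj₂ (universal ℛ-φ) i = s , trans (cong (λ e → run e i s) e-i) eq

    diagonal : ∀ t → fst (φ i) ≡ t → ⊥
    -- If `φ i` is special, `η b i` takes the value `snd i` at `0`. A special index for `b′` can
    -- take no value but its own `snd`, so `φ i` carries the same `k`, which would have to lie in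
    -- `b′`.
    diagonal zero fst-φi
      with s , eq ← output
      with s′ , eq′ ← Equivalence.to (reduces i 0 (snd i))
             (s , trans (ν-special {b} {i} fst-i)
                    (⇒special b (subst (λ k → 0 < b k) (sym k-i) k∈b)
                       (⇒outputsSpecial eq fst-φi) (proj₂ (unbounded 0))))
      with p , _ , _ , snd-φi ← special⇒ {b′} {φ i} {0} {s′}
             (trans (sym (ν-special {b′} {φ i} fst-φi)) eq′) =
      <⇒≢ p (sym (trans (cong b′ (trans (cong fst snd-φi) k-i)) k∉b′))
    -- If `φ i` is a base index, it converges at `0`. Then so does `i`, which happens only after `e`
    -- has output a special index.
    diagonal (suc t) fst-φi
      with s , q ← base-converges t (snd (φ i))
      with y , eq ← 0<⇒≡suc q
      with s′ , eq′ ← Equivalence.from (reduces i 0 y)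
             (s , trans (ν-base {b′} {φ i} fst-φi) eq)
      with _ , p , _ ← special⇒ {b} {i} {0} {s′}
             (trans (sym (ν-special {b} {i} fst-i)) eq′)
      with j , eq-j , fst-j ← outputsSpecial⇒ {snd (snd i)} {i} {s′} p =
      let j≡φi = PartialFunction.functional (limit {θ = run (snd (snd i))} (run-mono _))
                   (s′ , eq-j) output
      in 0≢1+n (trans (sym fst-j) (trans (cong fst j≡φi) fst-φi))

-- Orders as inclusion of computable sets.

record Decidedℛ {ℓ} (Q : ℕ → Set ℓ) : Set ℓ where
  field
    char   : ℕ → ℕ
    ℛ-char : ℛ 1 char
    char⇔  : ∀ k → 0 < char k ⇔ Q k

open Decidedℛ

module _ {ℓ ℓ′} {Q : ℕ → Set ℓ} {Q′ : ℕ → Set ℓ′} where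

  Decidedℛ-⇔ : (∀ k → Q k ⇔ Q′ k) → Decidedℛ Q → Decidedℛ Q′
  Decidedℛ-⇔ eq d = record
    { char = char d ; ℛ-char = ℛ-char d ; char⇔ = λ k → eq k ⇔-∘ char⇔ d k }

  Decidedℛ-× : Decidedℛ Q → Decidedℛ Q′ → Decidedℛ (λ k → Q k × Q′ k)
  Decidedℛ-× d d′ = record
    { char   = λ k → char d k * char d′ k
    ; ℛ-char = lam₁ (app₁ (char d) (ℛ-char d) (var 0F) ‵* app₁ (char d′) (ℛ-char d′) (var 0F))
    ; char⇔  = λ k → mk⇔
        (λ p → let q , q′ = 0<*⇒ (char d k) p in to (char⇔ d k) q , to (char⇔ d′ k) q′)
        (λ (q , q′) → *-mono-< (from (char⇔ d k) q) (from (char⇔ d′ k) q′))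
    }
    where open Equivalence

  Decidedℛ-⊎ : Decidedℛ Q → Decidedℛ Q′ → Decidedℛ (λ k → Q k ⊎ Q′ k)
  Decidedℛ-⊎ d d′ = record
    { char   = λ k → char d k + char d′ k
    ; ℛ-char = lam₁ (app₁ (char d) (ℛ-char d) (var 0F) ‵+ app₁ (char d′) (ℛ-char d′) (var 0F))
    ; char⇔  = λ k → mk⇔
        (Sum.map (to (char⇔ d k)) (to (char⇔ d′ k)) ∘ 0<+⇒ (char d k))
        [ (λ q → <-≤-trans (from (char⇔ d k) q) (m≤m+n _ _))
        , (λ q → <-≤-trans (from (char⇔ d′ k) q) (m≤n+m _ _)) ]′
    }
    where open Equivalence

-- Either truth value gives a constant characteristic function. This is how finitely many facts
-- about a noncomputable order enter a program.
Decidedℛ-const : ∀ {ℓ} {Q : Set ℓ} → Dec Q → Decidedℛ (λ _ → Q)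
Decidedℛ-const (yes q) = record
  { char = λ _ → 1 ; ℛ-char = lam₁ (‵const 1) ; char⇔ = λ _ → mk⇔ (λ _ → q) (λ _ → z<s) }
Decidedℛ-const (no ¬q) = record
  { char = λ _ → 0 ; ℛ-char = lam₁ (‵const 0) ; char⇔ = λ _ → mk⇔ (λ ()) (⊥-elim ∘ ¬q) }

-- Any transitive relation on ℕ is turned into inclusion of computable sets
-- {k | Up k n}.  The bits of k propose an up-set, and elements are decided in
-- order: n is in if some earlier element forces it in, or if it is proposed
-- and no earlier element forbids it.  Hence Up k n depends on finitely many
-- bits of k, however complicated the relation.
module UpSets
  (em : ∀ {ℓ} → ExcludedMiddle ℓ) (π : Pairing)
  {ℓ} (_⊑_ : ℕ → ℕ → Set ℓ) (⊑-trans : ∀ {i j k} → i ⊑ j → j ⊑ k → i ⊑ k)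
  where

  open Pairs π

  bit : ℕ → ℕ → ℕ
  bit zero    k = fst k
  bit (suc n) k = bit n (snd k)

  data Up (k : ℕ) : ℕ → Set ℓ where
    forced   : ∀ {m n} → m < n → m ⊑ n → Up k m → Up k n
    proposed : ∀ {n} → 0 < bit n k → (∀ m → m < n → n ⊑ m → Up k m) → Up k n

  -- For `m < n` this is forcing. For `n < m` the reason for `m` decides: an earlier `l ⊑ m` that
  -- forced `m` is also below `n`, and a proposed `m` was accepted only because `n` was already in.
  Up-mono : ∀ {k m n} → m ⊑ n → Up k m → Up k n
  Up-mono {k} {m} {n} m⊑n u with <-cmp m n
  Up-mono m⊑n u                      | tri< m<n _ _  = forced m<n m⊑n u
  Up-mono m⊑n u                      | tri≈ _ refl _ = u
  Up-mono m⊑n (forced _ l⊑m u)       | tri> _ _ n<m  = Up-mono (⊑-trans l⊑m m⊑n) u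
  Up-mono m⊑n (proposed _ consistent) | tri> _ _ n<m = consistent _ n<m m⊑n

  bits-exist : ∀ N (Q : ℕ → Set ℓ) → ∃[ k ] (∀ {n} → n < N → 0 < bit n k ⇔ Q n)
  bits-exist zero    Q = 0 , λ ()
  bits-exist (suc N) Q with k , ok ← bits-exist N (Q ∘ suc) | em {P = Q 0}
  ... | d = ⟨ b , k ⟩ , λ
    { {zero}  _   → subst (λ b → 0 < b ⇔ Q 0) (sym (fst-⟨,⟩ b k)) (char⇔ (Decidedℛ-const d) 0)
    ; {suc n} n<N → subst (λ k → 0 < bit n k ⇔ Q (suc n)) (sym (snd-⟨,⟩ b k)) (ok (s<s⁻¹ n<N)) }
    where
    b : ℕ
    b = char (Decidedℛ-const d) 0

  -- Let the bits of `k` describe the principal up-set of `m` as far as `m` and `n`. By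
  -- transitivity, forcing adds nothing to it and the consistency check rejects nothing, so `Up k`
  -- agrees with it there.
  Up-separates : ∀ {m n} → m ⊑ m → ¬ m ⊑ n → ∃[ k ] Up k m × ¬ Up k n
  Up-separates {m} {n} m⊑m m⋢n
    with k , bits ← bits-exist (suc (m ⊔ n)) (m ⊑_) =
    k , complete (s≤s (m≤m⊔n m n)) m⊑m , m⋢n ∘ sound (s≤s (m≤n⊔m m n))
    where
    sound : ∀ {i} → i < suc (m ⊔ n) → Up k i → m ⊑ i
    sound i<N (forced j<i j⊑i u) = ⊑-trans (sound (<-trans j<i i<N) u) j⊑i
    sound i<N (proposed p _)     = Equivalence.to (bits i<N) p

    complete : ∀ {i} → i < suc (m ⊔ n) → m ⊑ i → Up k i
    complete {i} = <-rec (λ i → i < suc (m ⊔ n) → m ⊑ i → Up k i)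
      (λ i rec i<N m⊑i → proposed (Equivalence.from (bits i<N) m⊑i)
         (λ j j<i i⊑j → rec j<i (<-trans j<i i<N) (⊑-trans m⊑i i⊑j))) i

  -- All bits of `0` vanish, so nothing starts the forcing. This supplies the condition `b 0 ≡ 0` of
  -- the numberings.
  0∉Up : ∀ {n} → ¬ Up 0 n
  0∉Up (forced _ _ u)     = 0∉Up u
  0∉Up {n} (proposed p _) = <⇒≢ p (sym (bit-0 n))
    where
    bit-0 : ∀ n → bit n 0 ≡ 0
    bit-0 zero = n≤0⇒n≡0 (fst≤id 0)
    bit-0 (suc n) rewrite n≤0⇒n≡0 (snd≤id 0) = bit-0 n

  ‵bit : ∀ n → Computable f → Computable (λ xs → bit n (f xs))
  ‵bit zero    cf = ‵fst cf
  ‵bit (suc n) cf = ‵bit n (‵snd cf)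

  bit-decided : ∀ n → Decidedℛ (λ k → 0 < bit n k)
  bit-decided n = record
    { char = bit n ; ℛ-char = lam₁ (‵bit n (var 0F)) ; char⇔ = λ _ → mk⇔ id id }

  module _ {n} (Up-decided : ∀ {m} → m < n → Decidedℛ (λ k → Up k m)) where

    forced-decided : ∀ {j} → j ≤ n → Decidedℛ (λ k → ∃[ m ] m < j × m ⊑ n × Up k m)
    forced-decided {zero}  _   = Decidedℛ-⇔ (λ k → mk⇔ ⊥-elim λ { (_ , () , _) })
                                   (Decidedℛ-const (no id))
    forced-decided {suc j} j<n = Decidedℛ-⇔
      (λ k → mk⇔
        [ (λ (m , m<j , q) → m , m<n⇒m<1+n m<j , q) , (λ q → j , ≤-refl , q) ]′
        (λ (m , m<1+j , q) → [ (λ m<j → inj₁ (m , m<j , q)) , (λ { refl → inj₂ q }) ]′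
                               (m<1+n⇒m<n∨m≡n m<1+j)))
      (Decidedℛ-⊎ (forced-decided (<⇒≤ j<n))
                  (Decidedℛ-× (Decidedℛ-const em) (Up-decided j<n)))

    consistent-decided : ∀ {j} → j ≤ n → Decidedℛ (λ k → ∀ m → m < j → n ⊑ m → Up k m)
    consistent-decided {zero}  _   = Decidedℛ-⇔ (λ k → mk⇔ (λ _ _ ()) (λ _ → tt))
                                       (Decidedℛ-const (yes tt))
    consistent-decided {suc j} j<n = Decidedℛ-⇔
      (λ k → mk⇔
        (λ (p , q) m m<1+j n⊑m → [ (λ m<j → p m m<j n⊑m)
                               , (λ { refl → [ contradiction n⊑m , id ]′ q }) ]′
                               (m<1+n⇒m<n∨m≡n m<1+j))
        (λ p → (λ m m<j → p m (m<n⇒m<1+n m<j)) ,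
               [ (λ n⊑j → inj₂ (p j ≤-refl n⊑j)) , inj₁ ]′ (toSum (em {P = n ⊑ j}))))
      -- The implication from `n ⊑ j` becomes a disjunction, since its premise is constant in `k`.
      (Decidedℛ-× (consistent-decided (<⇒≤ j<n))
                  (Decidedℛ-⊎ (Decidedℛ-const (em {P = ¬ n ⊑ j})) (Up-decided j<n)))

  abstract
    Up-decided : ∀ n → Decidedℛ (λ k → Up k n)
    Up-decided = <-rec _ λ n rec → Decidedℛ-⇔
      (λ k → mk⇔ [ (λ (m , m<n , m⊑n , u) → forced m<n m⊑n u) , uncurry proposed ]′
                 (λ { (forced m<n m⊑n u) → inj₁ (_ , m<n , m⊑n , u)
                    ; (proposed p q)     → inj₂ (p , q) }))
      (Decidedℛ-⊎ (forced-decided rec ≤-refl)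
                  (Decidedℛ-× (bit-decided n) (consistent-decided rec ≤-refl)))

theorem8p12 : (∀ {ℓ} → ExcludedMiddle ℓ) →
    (π : Pairing) (A : Pred ℕ 0ℓ) →
    ComputablyEnumerable A → Infinite A →
    ∀ {c ℓ₁ ℓ₂} (P : Poset c ℓ₁ ℓ₂) → Countable P →
    EmbedsInto P (Rogers π A)
theorem8p12 em π A (inj₁ empty) infinite P P↣ℕ =
  contradiction (List.[] , λ a Aa → contradiction Aa (empty a)) infinite
theorem8p12 em π A (inj₂ (α , ℛ-α , range-α)) infinite P P↣ℕ =
  (λ p → numbering (ℛ-char (Up-decided (index p))) (0∉upSet p)) , record
    { isOrderHomomorphism = record
      { cong = λ p≈q → ≼⇒≤ₘ (reflexive p≈q) ,
                       ≼⇒≤ₘ (reflexive (Eq.sym p≈q))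
      ; mono = ≼⇒≤ₘ
      }
    ; injective = λ (Jp≤Jq , Jq≤Jp) → antisym (≤ₘ⇒≼ Jp≤Jq) (≤ₘ⇒≼ Jq≤Jp)
    ; cancel    = ≤ₘ⇒≼
    }
  where
  open Poset P using (Carrier; module Eq; reflexive; antisym)
    renaming (_≤_ to _≼_; refl to refl-≼; trans to trans-≼)
  open Injection P↣ℕ using (injective) renaming (to to index)
  open Equivalence using (to; from)

  -- `index` may miss numbers; these are related to nothing, not even to themselves, so `⊑` is
  -- reflexive only on the image.
  _⊑_ : ℕ → ℕ → Set _
  m ⊑ n = ∃[ p ] ∃[ q ] index p ≡ m × index q ≡ n × p ≼ q

  index-cancel : ∀ {p q} → index p ⊑ index q → p ≼ q
  index-cancel (p′ , q′ , p′≡p , q′≡q , p′≼q′) =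
    trans-≼ (reflexive (Eq.sym (injective p′≡p)))
      (trans-≼ p′≼q′ (reflexive (injective q′≡q)))

  ⊑-trans : ∀ {i j k} → i ⊑ j → j ⊑ k → i ⊑ k
  ⊑-trans (p , q , p≡i , refl , p≼q) (q′ , r , q′≡q , r≡k , q′≼r) =
    p , r , p≡i , r≡k , trans-≼ p≼q (index-cancel (q′ , r , q′≡q , refl , q′≼r))

  open UpSets em π _⊑_ ⊑-trans

  unbounded : ∀ x → ∃[ t ] x < α t
  unbounded x with a , Aa , x<a ← Classical.infinite⇒unbounded em infinite x
              with t , refl ← to (range-α a) Aa = t , x<a

  open Numbering em π (universalFunction π) A α ℛ-α range-α unbounded

  upSet : Carrier → ℕ → ℕ
  upSet p = char (Up-decided (index p))

  0∉upSet : ∀ p → upSet p 0 ≡ 0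
  0∉upSet p = ≮0⇒≡0 (0∉Up ∘ to (char⇔ (Up-decided (index p)) 0))

  ≼⇒≤ₘ : ∀ {p q} → p ≼ q → η (upSet p) ≤ₘ η (upSet q)
  ≼⇒≤ₘ {p} {q} p≼q = ⊆⇒≤ₘ {upSet p} {upSet q} (ℛ-char (Up-decided (index p))) (0∉upSet q)
    λ {k} → from (char⇔ (Up-decided (index q)) k)
          ∘ Up-mono (p , q , refl , refl , p≼q)
          ∘ to (char⇔ (Up-decided (index p)) k)

  ⋠⇒≰ₘ : ∀ {p q} → ¬ p ≼ q → ¬ η (upSet p) ≤ₘ η (upSet q)
  ⋠⇒≰ₘ {p} {q} p⋠q
    with k , k∈p , k∉q ← Up-separates (p , p , refl , refl , refl-≼) (p⋠q ∘ index-cancel) =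
    ⊈⇒≰ₘ {upSet p} {upSet q} (from (char⇔ (Up-decided (index p)) k) k∈p)
                             (≮0⇒≡0 (k∉q ∘ to (char⇔ (Up-decided (index q)) k)))

  ≤ₘ⇒≼ : ∀ {p q} → η (upSet p) ≤ₘ η (upSet q) → p ≼ q
  ≤ₘ⇒≼ p≤q = decidable-stable em λ p⋠q → ⋠⇒≰ₘ p⋠q p≤q
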